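{- Let $n\ge 3$. If two simplices $\Delta$ and $\Delta'$ of the triangulation $\mathcal{T}_n^{\mathrm{LRL}}$ are adjacent, then their corresponding integer flows $\phi(\Delta)$ and $\phi(\Delta')$ in $\mathcal{F}_n^{\mathbb{Z}}$ are adjacent, that is, they differ by one of the elementary moves: there is some $i$ with $2\le i\le n-1$ such that $\phi(\Delta')=m_i^+(\phi(\Delta))$ or $\phi(\Delta')=m_i^-(\phi(\Delta))$ (the move being applicable).
   Context: The contracted zigzag graph $G_n$ (written $\widehat{\mathrm{Zig}}_n$) is the directed multigraph with vertices $1,\dots,n$ and edges $x_i=(i,i+1)$ for $1\le i\le n-1$ (slack edges), $y_0=(1,2)$, $y_i=(i,i+2)$ for $1\le i\le n-2$, and $y_{n-1}=(n-1,n)$ (nonslack edges). The inner vertices are $2,\dots,n-1$. Each inner vertex $i$ has incoming edges $\{x_{i-1},y_{i-2}\}$ and outgoing edges $\{x_i,y_i\}$. The length-reverse-length (LRL) framing orders them by $y_{i-2}\prec x_{i-1}$ (incoming) and $x_i\prec y_i$ (outgoing) at every inner vertex $i$. A route is a directed path from $1$ to $n$; a prefix at $i$ is a directed path from $1$ to $i$; a suffix at $i$ is a directed path from $i$ to $n$. Paths are sequences of edges (parallel edges are distinguished). For distinct prefixes $P,P'$ at an inner vertex $i$, let $j\le i$ be the vertex after which they coincide and which they enter along different edges $e$ (of $P$) and $e'$ (of $P'$); set $P\prec P'$ if $e\prec e'$ in the incoming order at $j$. For distinct suffixes $Q,Q'$ at $i$, let $k\ge i$ be the first vertex which they leave along different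 edges $e$ (of $Q$), $e'$ (of $Q'$); set $Q\prec Q'$ if $e\prec e'$ in the outgoing order at $k$. Two routes $R=PiQ$ and $R'=P'iQ'$ through a common inner vertex $i$ (with prefixes $P,P'$ and suffixes $Q,Q'$ at $i$) conflict at $i$ if the prefixes and suffixes are oppositely ordered ($P\prec P'$ and $Q'\prec Q$, or vice versa). A maximal clique is an inclusion-maximal set of routes no two of which conflict at any vertex. Each route is identified with its 0/1 indicator vector in $\mathbb{R}^{E(G_n)}$, a vertex of the flow polytope of nonnegative unit flows from $1$ to $n$. For a maximal clique $C$, $\Delta_C$ is the convex hull of its routes; the $\Delta_C$ are the maximal simplices of a regular unimodular triangulation of this flow polytope (Danilov–Karzanov–Koshevoy). $\mathcal{T}_n^{\mathrm{LRL}}$ denotes the set of these simplices. Two simplices are adjacent if they share a codimension 1 face, equivalently if their maximal cliques differ by exactly one route. $\mathcal{F}_n^{\mathbb{Z}}$ is the set of functions $\phi:E(G_n)\to\mathbb{Z}_{\ge0}$ with $\sum_{e\text{ into }i}\phi(e)+d_i=\sum_{e\text{ out of }i}\phi(e)$ for every vertex $i$, where $(d_1,\dots,d_n)=(0,1,1,\dots,1,-(n-2))$. There is a bijection (Mészáros–Morales–Striker) $\Delta_C\mapsto\phi(\Delta_C)$ from $\mathcal{T}_n^{\mathrm{LRL}}$ to $\mathcal{F}_n^{\mathbb{Z}}$: $\phi(\Delta_C)(e)=0$ if $e$ leaves vertex $1$, and if $e$ leaves an inner vertex $i$, then $\phi(\Delta_C)(e)$ is one less than the number of prefixes $P$ at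 $i$ such that some route of $C$ begins with $P$ followed by $e$. Elementary moves on $\mathcal{F}_n^{\mathbb{Z}}$, for $2\le i\le n-1$: if $\phi(x_i)>0$ and $\phi(y_{i+1})>0$, then $m_i^+(\phi)$ is the flow obtained by subtracting one from $\phi(x_i)$ and $\phi(y_{i+1})$ and adding one to $\phi(x_{i+2})$ and $\phi(y_i)$; otherwise $m_i^+$ does not apply. If $\phi(x_{i+2})>0$ and $\phi(y_i)>0$, then $m_i^-(\phi)$ is the flow obtained by subtracting one from $\phi(x_{i+2})$ and $\phi(y_i)$ and adding one to $\phi(x_i)$ and $\phi(y_{i+1})$; otherwise $m_i^-$ does not apply. When $i\in\{n-2,n-1\}$, all conditions and operations involving the nonexistent values $\phi(x_n),\phi(y_n),\phi(x_{n+1})$ are ignored. -}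

module Defs where

open import Data.Bool.Base using (if_then_else_)
open import Data.Integer.Base as ℤ using (ℤ; 0ℤ; 1ℤ; +_)
open import Data.List.Base using (List; []; _∷_; _++_; [_]; length; filter; inits; concatMap; deduplicate)
open import Data.List.Membership.Propositional using (_∈_; _∉_)
import Data.List.Membership.DecPropositional as DecMembership
open import Data.List.Properties using (≡-dec)
open import Data.List.Relation.Binary.Prefix.Heterogeneous.Properties using (prefix?)
open import Data.List.Relation.Binary.Subset.Propositional using (_⊆_)
open import Data.List.Relation.Unary.Any using (any?)
open import Data.Nat.Base using (ℕ; zero; suc; _+_; _≤_; _<_; _⊓_)
import Data.Nat.Properties as ℕ
open import Data.Product.Base using (_×_; ∃-syntax)
open import Data.Sum.Base using (_⊎_)
open import Function.Bundles using (_⇔_)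
open import Relation.Binary.Definitions using (DecidableEquality)
open import Relation.Binary.PropositionalEquality using (_≡_; _≢_; refl; cong)
open import Relation.Nullary.Decidable using (does; no; map′)
open import Relation.Nullary.Negation using (¬_)

variable
  n : ℕ

data Label : Set where
  x y : ℕ → Label

IsEdge : ℕ → Label → Set
IsEdge n (x i) = 1 ≤ i × i < n
IsEdge n (y i) = i < n

record Edge (n : ℕ) : Set where
  constructor edge
  field
    label   : Label
    .isEdge : IsEdge n label

open Edge public

_≟ˡ_ : DecidableEquality Label
x i ≟ˡ x j = map′ (cong x) (λ { refl → refl }) (i ℕ.≟ j)
x i ≟ˡ y j = no λ ()
y i ≟ˡ x j = no λ ()
y i ≟ˡ y j = map′ (cong y) (λ { refl → refl }) (i ℕ.≟ j)

label-injective : {e e′ : Edge n} → label e ≡ label e′ → e ≡ e′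
label-injective {e = edge _ _} {edge _ _} refl = refl

_≟ᵉ_ : DecidableEquality (Edge n)
e ≟ᵉ e′ = map′ label-injective (cong label) (label e ≟ˡ label e′)

source : Edge n → ℕ
source (edge (x i)       _) = i
source (edge (y zero)    _) = 1
source (edge (y (suc i)) _) = suc i

-- The minimum only matters for y (n ∸ 1), which ends at n rather than at n + 1.
target : Edge n → ℕ
target     (edge (x i) _) = suc i
target {n} (edge (y i) _) = n ⊓ (2 + i)

Inner : ℕ → ℕ → Set
Inner n i = 2 ≤ i × i < n

infix 4 _≺ⁱⁿ_ _≺ᵒᵘᵗ_ _≺ᵖ_ _≺ˢ_

-- The incoming edges of the inner vertex 2 + i are y i and x (1 + i).
_≺ⁱⁿ_ : Edge n → Edge n → Set
_≺ⁱⁿ_ {n} e e′ = ∃[ i ] Inner n (2 + i) × label e ≡ y i × label e′ ≡ x (1 + i)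

_≺ᵒᵘᵗ_ : Edge n → Edge n → Set
_≺ᵒᵘᵗ_ {n} e e′ = ∃[ i ] Inner n i × label e ≡ x i × label e′ ≡ y i

Path : ℕ → Set
Path n = List (Edge n)

IsPath : ℕ → Path n → ℕ → Set
IsPath i []      j = i ≡ j
IsPath i (e ∷ p) j = source e ≡ i × IsPath (target e) p j

IsRoute : Path n → Set
IsRoute {n} R = IsPath 1 R n

_≺ᵖ_ : Path n → Path n → Set
P ≺ᵖ P′ = ∃[ A ] ∃[ e ] ∃[ A′ ] ∃[ e′ ] ∃[ S ]
  P ≡ A ++ e ∷ S × P′ ≡ A′ ++ e′ ∷ S × e ≺ⁱⁿ e′

_≺ˢ_ : Path n → Path n → Set
Q ≺ˢ Q′ = ∃[ S ] ∃[ e ] ∃[ B ] ∃[ e′ ] ∃[ B′ ]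
  Q ≡ S ++ e ∷ B × Q′ ≡ S ++ e′ ∷ B′ × e ≺ᵒᵘᵗ e′

SplitsAt : ℕ → Path n → Path n → Path n → Set
SplitsAt {n} i R P Q = R ≡ P ++ Q × IsPath 1 P i × IsPath i Q n

ConflictAt : ℕ → Path n → Path n → Set
ConflictAt {n} i R R′ = Inner n i × ∃[ P ] ∃[ Q ] ∃[ P′ ] ∃[ Q′ ]
  SplitsAt i R P Q × SplitsAt i R′ P′ Q′ ×
  ((P ≺ᵖ P′ × Q′ ≺ˢ Q) ⊎ (P′ ≺ᵖ P × Q ≺ˢ Q′))

-- A finite set of routes is represented by a list; order and repetition are
-- irrelevant to everything below, which depends on membership only.

record IsClique (C : List (Path n)) : Set where
  field
    routes      : ∀ {R} → R ∈ C → IsRoute R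
    nonconflict : ∀ {R R′} → R ∈ C → R′ ∈ C → ∀ i → ¬ ConflictAt i R R′

record IsMaximalClique (C : List (Path n)) : Set where
  field
    isClique : IsClique C
    maximal  : ∀ D → IsClique D → C ⊆ D → D ⊆ C

-- A simplex of the triangulation, given by its set of vertices.
record Simplex (n : ℕ) : Set where
  field
    clique          : List (Path n)
    isMaximalClique : IsMaximalClique clique

open Simplex public

-- The common facet has vertex set C ∖ {R} = C′ ∖ {R′}.
Adjacent : Simplex n → Simplex n → Set
Adjacent Δ Δ′ = ∃[ R ] ∃[ R′ ]
  R ∈ C × R ∉ C′ × R′ ∈ C′ × R′ ∉ C ×
  (∀ S → S ≢ R → S ≢ R′ → S ∈ C ⇔ S ∈ C′)
  where
  C  = clique Δ
  C′ = clique Δ′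

-- The paths P, without repetition, such that some route of C begins with P
-- followed by e.  For a set of routes these are prefixes at source e.
prefixesBefore : List (Path n) → Edge n → List (Path n)
prefixesBefore C e =
  deduplicate (≡-dec _≟ᵉ_)
    (filter (λ P → any? (prefix? _≟ᵉ_ (P ++ [ e ])) C) (concatMap inits C))

φ : Simplex n → Edge n → ℤ
φ Δ e = if does (source e ℕ.≟ 1)
        then 0ℤ
        else + length (prefixesBefore (clique Δ) e) ℤ.- 1ℤ

-- Labels in these lists that are not edges of the graph have no effect, since
-- all conditions and updates range over Edge n.
lower upper : ℕ → List Label
lower i = x i ∷ y (1 + i) ∷ []
upper i = x (2 + i) ∷ y i ∷ []

PositiveOn : List Label → (Edge n → ℤ) → Set
PositiveOn ls f = ∀ e → label e ∈ ls → 0ℤ ℤ.< f e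

indicator : List Label → Edge n → ℤ
indicator ls e = if does (label e ∈? ls) then 1ℤ else 0ℤ
  where open DecMembership _≟ˡ_ using (_∈?_)

transfer : (from to : List Label) → (Edge n → ℤ) → Edge n → ℤ
transfer from to f e = f e ℤ.- indicator from e ℤ.+ indicator to e

-- g is the result of the move on f, which applies to f.
MovesTo⁺ MovesTo⁻ : ℕ → (f g : Edge n → ℤ) → Set
MovesTo⁺ i f g = PositiveOn (lower i) f ×
  (∀ e → g e ≡ transfer (lower i) (upper i) f e)
MovesTo⁻ i f g = PositiveOn (upper i) f ×
  (∀ e → g e ≡ transfer (upper i) (lower i) f e)

AdjacentFlows : (f g : Edge n → ℤ) → Set
AdjacentFlows {n} f g = ∃[ i ] Inner n i × (MovesTo⁺ i f g ⊎ MovesTo⁻ i f g)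

{-# OPTIONS --safe #-}

-- In a maximal clique C the prefixes at an inner vertex j are linearly ordered,
-- and exactly one of them, the cut, is followed in C both by x_j and by y_j:
-- lower prefixes are followed by x_j only, higher ones by y_j only.  Maximality
-- enters through the fact that a prefix crossing no route of C can be extended
-- greedily, so that it already occurs in C.
--
-- Let C and C′ differ by R and R′, and let b be the first vertex where their
-- cuts c and c′ differ, say c below c′.  Every prefix occurring in only one of
-- the two cliques extends to R or R′ only, so it has a single continuation and
-- is never a cut.  Hence R runs through c and y_b, after which it is the lowest
-- prefix at b + 2 and must follow x_{b+2}; R′ runs through c′ and x_b, after
-- which it is the highest prefix at b + 1 and must follow y_{b+1}.  At b + 3
-- both have the same position among the common prefixes, so they continue along
-- the same edges.  The sets of prefixes counted by φ therefore change by one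
-- exactly at y_b, x_{b+2}, x_b and y_{b+1}.

module Submission where

open import Data.Bool.Base using (Bool; true; false; not; if_then_else_)
open import Data.Bool.Properties using (¬-not) renaming (_≟_ to _≟ᵇ_)
open import Data.Empty using (⊥; ⊥-elim)
open import Data.Integer.Base as ℤ using (ℤ; 0ℤ; 1ℤ; +_)
open import Data.Integer.Tactic.RingSolver using (solve-∀)
open import Data.List.Base
  using (List; []; _∷_; _++_; _ʳ++_; [_]; reverse; map; filter; inits; concatMap; length)
import Data.List.Membership.DecPropositional as DecMembership
open import Data.List.Membership.Propositional using (_∈_; _∉_; lose; find)
open import Data.List.Membership.Propositional.Properties
  using (∈-map⁺; ∈-concatMap⁺; ∈-filter⁺; ∈-filter⁻; ∈-deduplicate⁺; ∈-deduplicate⁻; ∈-++⁺ˡ; ∈-++⁺ʳ; ∈-++⁻)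
open import Data.List.Membership.Propositional.Properties.WithK using (unique∧set⇒bag)
open import Data.List.Properties
  using (∷-injectiveˡ; ∷-injectiveʳ; ++-assoc; length-++; ++-identityʳ; ++-ʳ++; ʳ++-ʳ++; ʳ++-defn;
         unfold-reverse; reverse-++; reverse-involutive; ≡-dec)
open import Data.List.Relation.Binary.BagAndSetEquality using (∼bag⇒↭)
open import Data.List.Relation.Binary.Permutation.Propositional.Properties using (↭-length)
open import Data.List.Relation.Binary.Prefix.Heterogeneous using (Prefix; []; _∷_)
open import Data.List.Relation.Binary.Prefix.Heterogeneous.Properties using (prefix?)
open import Data.List.Relation.Unary.All as All using (All; []; _∷_)
open import Data.List.Relation.Unary.Any using (Any; here; there; any?)
open import Data.List.Relation.Unary.Unique.DecPropositional.Properties using (deduplicate-!)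
open import Data.List.Relation.Unary.Unique.Propositional using (Unique; []; _∷_)
open import Data.List.Relation.Unary.Unique.Propositional.Properties using () renaming (++⁺ to Unique-++⁺)
open import Data.Nat.Base using (ℕ; zero; suc; _+_; _≤_; _<_; _⊓_; s≤s; z≤n)
open import Data.Nat.Properties
open import Data.Product.Base using (_×_; _,_; ∃-syntax; proj₁; proj₂)
open import Data.Sum.Base using (_⊎_; inj₁; inj₂; [_,_]′; reduce)
open import Data.Unit.Base using (⊤; tt)
open import Function.Base using (_∘_; id)
open import Function.Bundles using (_⇔_; mk⇔; Equivalence)
open import Level using (0ℓ)
open import Relation.Binary.Core using (Rel)
open import Relation.Binary.Definitions using (Transitive; tri<; tri≈; tri>)
open import Relation.Binary.PropositionalEquality hiding ([_])
open import Relation.Nullary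
  using (¬_; Dec; yes; no; contradiction; map′; recompute; _×-dec_; _⊎-dec_; does)
open import Relation.Nullary.Decidable using (dec-true; dec-false)

open import Defs

-- Lists: reversed prefixes and least elements.

module _ {a} {A : Set a} where

  ʳ++-cancelˡ : ∀ (p : List A) {B B′} → p ʳ++ B ≡ p ʳ++ B′ → B ≡ B′
  ʳ++-cancelˡ []      eq = eq
  ʳ++-cancelˡ (_ ∷ p) eq = ∷-injectiveʳ (ʳ++-cancelˡ p eq)

  reverse-ʳ++ : ∀ (P : List A) {B} → reverse P ʳ++ B ≡ P ++ B
  reverse-ʳ++ P = ʳ++-ʳ++ P

  ++-comparable : ∀ (P Q : List A) {B B′} → P ++ B ≡ Q ++ B′ →
    (∃[ M ] P ≡ Q ++ M) ⊎ (∃[ M ] Q ≡ P ++ M)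
  ++-comparable []      Q       eq = inj₂ (Q , refl)
  ++-comparable (e ∷ P) []      eq = inj₁ (e ∷ P , refl)
  ++-comparable (e ∷ P) (f ∷ Q) eq with ∷-injectiveˡ eq | ++-comparable P Q (∷-injectiveʳ eq)
  ... | refl | inj₁ (M , refl) = inj₁ (M , refl)
  ... | refl | inj₂ (M , refl) = inj₂ (M , refl)

  reverse-≡-++ : ∀ (p q M : List A) → reverse p ≡ reverse q ++ M → p ≡ reverse M ++ q
  reverse-≡-++ p q M eq = begin
    p                                ≡⟨ reverse-involutive p ⟨
    reverse (reverse p)              ≡⟨ cong reverse eq ⟩
    reverse (reverse q ++ M)         ≡⟨ reverse-++ (reverse q) M ⟩
    reverse M ++ reverse (reverse q) ≡⟨ cong (reverse M ++_) (reverse-involutive q) ⟩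
    reverse M ++ q                   ∎
    where open ≡-Reasoning

  -- Prefixes of one list are nested; stored in reverse, the shorter one is a tail of the longer
  -- one.
  ʳ++-comparable : ∀ (p q : List A) {B B′} → p ʳ++ B ≡ q ʳ++ B′ →
    (∃[ M ] p ≡ M ++ q) ⊎ (∃[ M ] q ≡ M ++ p)
  ʳ++-comparable p q eq
    with ++-comparable (reverse p) (reverse q) (trans (sym (ʳ++-defn p)) (trans eq (ʳ++-defn q)))
  ... | inj₁ (M , eq′) = inj₁ (reverse M , reverse-≡-++ p q M eq′)
  ... | inj₂ (M , eq′) = inj₂ (reverse M , reverse-≡-++ q p M eq′)

  ʳ++-flip : ∀ (p q : List A) {B} → p ʳ++ [] ≡ q ʳ++ B → p ≡ B ʳ++ q
  ʳ++-flip p q {B} eq = begin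
    p                    ≡⟨ reverse-involutive p ⟨
    (p ʳ++ []) ʳ++ []    ≡⟨ cong reverse eq ⟩
    (q ʳ++ B) ʳ++ []     ≡⟨ ʳ++-ʳ++ q ⟩
    B ʳ++ q ++ []        ≡⟨ cong (B ʳ++_) (++-identityʳ q) ⟩
    B ʳ++ q              ∎
    where open ≡-Reasoning

  Prefix⇒++ : ∀ {P R : List A} → Prefix _≡_ P R → ∃[ B ] R ≡ P ++ B
  Prefix⇒++ []         = _ , refl
  Prefix⇒++ (refl ∷ π) with Prefix⇒++ π
  ... | B , refl = B , refl

  ++⇒Prefix : ∀ (P : List A) {B} → Prefix _≡_ P (P ++ B)
  ++⇒Prefix []      = []
  ++⇒Prefix (_ ∷ P) = refl ∷ ++⇒Prefix P

  ∈-inits⁺ : ∀ (P : List A) {B} → P ∈ inits (P ++ B)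
  ∈-inits⁺ []      = here refl
  ∈-inits⁺ (e ∷ P) {B} = there (go e P)
    where
    go : ∀ e P {B} → e ∷ P ∈ Data.List.Base.Inits.tail (e ∷ P ++ B)
    go e []      = here refl
    go e (f ∷ P) = there (∈-map⁺ (e ∷_) (go f P))

  -- Totality is asked only among elements satisfying `P`, because two prefixes are known to be
  -- comparable only when they end at the same vertex below `n`. Reflexivity comes from comparing an
  -- element with itself.
  least : ∀ {ℓ p} {_≤′_ : Rel A ℓ} (P : A → Set p) → Transitive _≤′_ →
    (∀ {u v} → P u → P v → u ≤′ v ⊎ v ≤′ u) →
    ∀ {u us} → u ∈ us → All P us → ∃[ m ] m ∈ us × (∀ {v} → v ∈ us → m ≤′ v)
  least P tr tot {us = u ∷ []}     _ (pu ∷ []) = u , here refl , λ { (here refl) → reduce (tot pu pu) }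
  least P tr tot {us = u ∷ w ∷ ws} _ (pu ∷ ps) with least P tr tot (here refl) ps
  ... | m , m∈ , m≤ with tot pu (All.lookup ps m∈)
  ...   | inj₁ u≤m = u , here refl ,
          λ { (here refl) → reduce (tot pu pu) ; (there v∈) → tr u≤m (m≤ v∈) }
  ...   | inj₂ m≤u = m , there m∈ , λ { (here refl) → m≤u ; (there v∈) → m≤ v∈ }

open DecMembership _≟ˡ_ using () renaming (_∈?_ to _∈ˡ?_)

#_ : ∀ {a} {A : Set a} → Dec A → ℕ
# d = if does d then 1 else 0

-- Edges and slackness.

module _ {n : ℕ} where
  open DecMembership (_≟ᵉ_ {n}) using () renaming (_∈?_ to _∈ᵉ?_) public

  -- An inner vertex has one slack and one nonslack edge on either side, so this bit determines both
  -- framing orders: nonslack is lower among incoming edges, slack is lower among outgoing ones.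
  slack : Edge n → Bool
  slack (edge (x _) _) = true
  slack (edge (y _) _) = false

  ⊓<⇒≡ : ∀ {m} → n ⊓ m < n → n ⊓ m ≡ m
  ⊓<⇒≡ {m} lt with ≤-total n m
  ... | inj₁ n≤m = contradiction (m≤n⇒m⊓n≡m n≤m) (<⇒≢ lt)
  ... | inj₂ m≤n = m≥n⇒m⊓n≡n m≤n

  -- Decidability lets `recompute` recover the irrelevant field `isEdge`.
  isEdge? : ∀ l → Dec (IsEdge n l)
  isEdge? (x i) = (1 ≤? i) ×-dec (i <? n)
  isEdge? (y i) = i <? n

  1≤source : ∀ e → 1 ≤ source {n} e
  1≤source (edge (x i) h) = proj₁ (recompute (isEdge? (x i)) h)
  1≤source (edge (y zero) _) = ≤-refl
  1≤source (edge (y (suc i)) _) = s≤s z≤n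

  target≤n : ∀ e → target {n} e ≤ n
  target≤n (edge (x i) h) = proj₂ (recompute (isEdge? (x i)) h)
  target≤n (edge (y i) _) = m⊓n≤m n _

  -- The bound excludes vertex 1, which the two nonslack edges `y 0` and `y 1` leave.
  source-slack-injective : ∀ {e f : Edge n} → 2 ≤ source e → source e ≡ source f →
    slack e ≡ slack f → e ≡ f
  source-slack-injective {edge (x i) _} {edge (x j) _} _ eq _ = label-injective (cong x eq)
  source-slack-injective {edge (x i) _} {edge (y j) _} _ eq ()
  source-slack-injective {edge (y i) _} {edge (x j) _} _ eq ()
  source-slack-injective {edge (y zero) _} {_} (s≤s ()) _ _
  source-slack-injective {edge (y (suc zero)) _} {edge (y zero) _} (s≤s ()) _ _
  source-slack-injective {edge (y (suc i)) _} {edge (y (suc j)) _} _ eq _ = label-injective (cong y eq)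

  -- The bound excludes vertex `n`, where the last two nonslack edges both end; below `n` the
  -- minimum in `target` has no effect.
  target-slack-injective : ∀ {e f : Edge n} → target e < n → target e ≡ target f →
    slack e ≡ slack f → e ≡ f
  target-slack-injective {edge (x i) _} {edge (x j) _} _ eq _ = label-injective (cong x (suc-injective eq))
  target-slack-injective {edge (x i) _} {edge (y j) _} _ eq ()
  target-slack-injective {edge (y i) _} {edge (x j) _} _ eq ()
  target-slack-injective {edge (y i) _} {edge (y j) _} lt eq _ =
    label-injective (cong y (suc-injective (suc-injective
      (trans (sym (⊓<⇒≡ lt)) (trans eq (⊓<⇒≡ (subst (_< n) eq lt)))))))

  out : ∀ (s : Bool) {j} → 1 ≤ j → j < n → Edge n
  out true  {j} 1≤j j<n = edge (x j) (1≤j , j<n)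
  out false {j} 1≤j j<n = edge (y j) j<n

  source-out : ∀ (s : Bool) {j} (1≤j : 1 ≤ j) (j<n : j < n) → source (out s 1≤j j<n) ≡ j
  source-out true  1≤j j<n = refl
  source-out false {suc j} 1≤j j<n = refl

  slack-out : ∀ (s : Bool) {j} (1≤j : 1 ≤ j) (j<n : j < n) → slack (out s 1≤j j<n) ≡ s
  slack-out true  1≤j j<n = refl
  slack-out false 1≤j j<n = refl

  slack-label : ∀ {f : Edge n} {j} → slack f ≡ true → source f ≡ j → label f ≡ x j
  slack-label {edge (x i) _} _ refl = refl
  slack-label {edge (y i) _} () _

  nonslack-label : ∀ {f : Edge n} {j} → 2 ≤ j → slack f ≡ false → source f ≡ j → label f ≡ y j
  nonslack-label {edge (y (suc i)) _} _ _ refl = refl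
  nonslack-label {edge (y zero) _} (s≤s ()) _ refl
  nonslack-label {edge (x i) _} _ () _

  target-x : ∀ {f : Edge n} {j} → label f ≡ x j → target f ≡ suc j
  target-x {edge _ _} refl = refl

  target-y : ∀ {f : Edge n} {j} → label f ≡ y j → target f ≡ n ⊓ (2 + j)
  target-y {edge _ _} refl = refl

  label-x⇒<n : ∀ {f : Edge n} {j} → label f ≡ x j → j < n
  label-x⇒<n {edge (x j) h} refl = proj₂ (recompute (isEdge? (x j)) h)

  label-y⇒<n : ∀ {f : Edge n} {j} → label f ≡ y j → j < n
  label-y⇒<n {edge (y j) h} refl = recompute (isEdge? (y j)) h

  source-lower : ∀ {b} → 2 ≤ b → (e : Edge n) → label e ∈ lower b → 2 ≤ source e × source e < 3 + b
  source-lower 2≤b (edge _ _) (here refl) = 2≤b , m≤n+m _ 2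
  source-lower 2≤b (edge _ _) (there (here refl)) = ≤-trans 2≤b (n≤1+n _) , n≤1+n _

  source-upper : ∀ {b} → 2 ≤ b → (e : Edge n) → label e ∈ upper b → 2 ≤ source e × source e < 3 + b
  source-upper _ (edge _ _) (here refl) = s≤s (s≤s z≤n) , ≤-refl
  source-upper {suc b} 2≤b (edge _ _) (there (here refl)) = 2≤b , m≤n+m _ 2

  ≺ⁱⁿ⇒slack : ∀ {e f : Edge n} → e ≺ⁱⁿ f → slack e ≡ false × slack f ≡ true
  ≺ⁱⁿ⇒slack {edge _ _} {edge _ _} (_ , _ , refl , refl) = refl , refl

  slack⇒≺ⁱⁿ : ∀ {e f : Edge n} → target e ≡ target f → target e < n →
    slack e ≡ false → slack f ≡ true → e ≺ⁱⁿ f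
  slack⇒≺ⁱⁿ {edge (y i) _} {edge (x j) _} eq lt refl refl =
    i , (s≤s (s≤s z≤n) , subst (_< n) (⊓<⇒≡ lt) lt) , refl ,
    cong x (suc-injective (trans (sym eq) (⊓<⇒≡ lt)))
  slack⇒≺ⁱⁿ {edge (x i) _} {_} eq lt ()
  slack⇒≺ⁱⁿ {edge (y i) _} {edge (y j) _} eq lt _ ()

  ≺ᵒᵘᵗ⇒slack : ∀ {e f : Edge n} → e ≺ᵒᵘᵗ f →
    source e ≡ source f × slack e ≡ true × slack f ≡ false
  ≺ᵒᵘᵗ⇒slack {edge _ _} {edge _ _} (suc i , _ , refl , refl) = refl , refl , refl

  slack⇒≺ᵒᵘᵗ : ∀ {e f : Edge n} → source e ≡ source f → 2 ≤ source e →
    slack e ≡ true → slack f ≡ false → e ≺ᵒᵘᵗ f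
  slack⇒≺ᵒᵘᵗ {edge (x i) h} {edge (y zero) _} refl (s≤s ()) refl refl
  slack⇒≺ᵒᵘᵗ {edge (x i) h} {edge (y (suc j)) _} refl 2≤i refl refl =
    i , (2≤i , proj₂ (recompute (isEdge? (x i)) h)) , refl , refl
  slack⇒≺ᵒᵘᵗ {edge (x i) _} {edge (x j) _} _ _ refl ()
  slack⇒≺ᵒᵘᵗ {edge (y i) _} {_} _ _ ()

  -- From here on a prefix is a list of edges in reverse, last edge first, so
  -- that p ʳ++ B is the path p continued by B and _∷_ extends a prefix.

  end : Path n → ℕ
  end []      = 1
  end (e ∷ _) = target e

  Chain : Path n → Set
  Chain []      = ⊤
  Chain (e ∷ p) = source e ≡ end p × Chain p

  -- The order on prefixes, and crossings.

  infix 4 _⊏_ _≼_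

  -- The framing order on prefixes: in reverse, the common final stretch becomes a common head, so
  -- the comparison is structural. Targets are ignored, which makes asymmetry and transitivity hold
  -- for arbitrary lists.
  data _⊏_ : Rel (Path n) 0ℓ where
    here  : ∀ {e f p q} → slack e ≡ false → slack f ≡ true → e ∷ p ⊏ f ∷ q
    there : ∀ {e p q} → p ⊏ q → e ∷ p ⊏ e ∷ q

  _≼_ : Rel (Path n) 0ℓ
  p ≼ q = p ≡ q ⊎ p ⊏ q

  ⊏-asym : ∀ {p q} → p ⊏ q → ¬ q ⊏ p
  ⊏-asym (here a b)  (here c d)  = contradiction (trans (sym a) d) λ ()
  ⊏-asym (here a b)  (there _)   = contradiction (trans (sym a) b) λ ()
  ⊏-asym (there _)   (here a b)  = contradiction (trans (sym a) b) λ ()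
  ⊏-asym (there p⊏q) (there q⊏p) = ⊏-asym p⊏q q⊏p

  ⊏-irrefl : ∀ {p : Path n} → ¬ p ⊏ p
  ⊏-irrefl p⊏p = ⊏-asym p⊏p p⊏p

  ⊏-trans : Transitive _⊏_
  ⊏-trans (here a b)  (here c d)  = contradiction (trans (sym c) b) λ ()
  ⊏-trans (here a b)  (there _)   = here a b
  ⊏-trans (there _)   (here a b)  = here a b
  ⊏-trans (there p⊏q) (there q⊏r) = there (⊏-trans p⊏q q⊏r)

  ≼-trans : Transitive _≼_
  ≼-trans (inj₁ refl) q≼r         = q≼r
  ≼-trans (inj₂ p⊏q)  (inj₁ refl) = inj₂ p⊏q
  ≼-trans (inj₂ p⊏q)  (inj₂ q⊏r)  = inj₂ (⊏-trans p⊏q q⊏r)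

  ≼⇒⊐̸ : ∀ {p q} → p ≼ q → ¬ q ⊏ p
  ≼⇒⊐̸ (inj₁ refl) = ⊏-irrefl
  ≼⇒⊐̸ (inj₂ p⊏q)  = ⊏-asym p⊏q

  ≼-antisym : ∀ {p q} → p ≼ q → q ≼ p → p ≡ q
  ≼-antisym (inj₁ eq)  _   = eq
  ≼-antisym (inj₂ p⊏q) q≼p = contradiction p⊏q (≼⇒⊐̸ q≼p)

  ⊏-ʳ++ : ∀ S {p q} → p ⊏ q → S ʳ++ p ⊏ S ʳ++ q
  ⊏-ʳ++ []      p⊏q = p⊏q
  ⊏-ʳ++ (_ ∷ S) p⊏q = ⊏-ʳ++ S (there p⊏q)

  _⊏?_ : ∀ p q → Dec (p ⊏ q)
  []      ⊏? _       = no λ ()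
  (_ ∷ _) ⊏? []      = no λ ()
  (e ∷ p) ⊏? (f ∷ q) with e ≟ᵉ f
  ... | yes refl = map′ there (λ { (here a b) → contradiction (trans (sym a) b) λ () ; (there h) → h }) (p ⊏? q)
  ... | no e≢f   = map′ (λ { (a , b) → here a b })
                        (λ { (here a b) → a , b ; (there _) → contradiction refl e≢f })
                        ((slack e ≟ᵇ false) ×-dec (slack f ≟ᵇ true))

  ⊏⇒∷ : ∀ {p q} → p ⊏ q → ∃[ e ] ∃[ p′ ] p ≡ e ∷ p′
  ⊏⇒∷ (here _ _) = _ , _ , refl
  ⊏⇒∷ (there _) = _ , _ , refl

  -- Beyond s p q negates Side s q p for prefixes with the same end.
  Beyond : Bool → Rel (Path n) 0ℓ
  Beyond true  p q = q ⊏ p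
  Beyond false p q = p ⊏ q

  -- A conflict in local form, at the vertex where the two routes separate: the lower prefix takes
  -- the nonslack edge, which is the higher outgoing one, and the higher prefix takes the slack
  -- edge.
  record Crossing (e : Edge n) (p : Path n) (f : Edge n) (q : Path n) : Set where
    constructor _,_
    field
      opposite : slack f ≡ not (slack e)
      beyond   : Beyond (slack e) p q

  Crossing-sym : ∀ {e p f q} → Crossing e p f q → Crossing f q e p
  Crossing-sym {edge (x _) _} {p} {edge (y _) _} (refl , h) = refl , h
  Crossing-sym {edge (y _) _} {p} {edge (x _) _} (refl , h) = refl , h
  Crossing-sym {edge (x _) _} {p} {edge (x _) _} (() , h)
  Crossing-sym {edge (y _) _} {p} {edge (y _) _} (() , h)

  crossing : ∀ {e p f q} → slack e ≡ false → slack f ≡ true → p ⊏ q → Crossing e p f q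
  crossing {edge (y _) _} {f = edge (x _) _} _ _ p⊏q = refl , p⊏q
  crossing {edge (x _) _} ()
  crossing {f = edge (y _) _} _ ()

  Crossing-irrefl : ∀ {e p f} → ¬ Crossing e p f p
  Crossing-irrefl {edge (x _) _} (_ , p⊏p) = ⊏-irrefl p⊏p
  Crossing-irrefl {edge (y _) _} (_ , p⊏p) = ⊏-irrefl p⊏p

  -- Prefixes occurring in a set of routes.

  record Pre (C : List (Path n)) (p : Path n) : Set where
    constructor _,_
    field
      rest   : Path n
      member : p ʳ++ rest ∈ C

  Pre-tail : ∀ {C e p} → Pre C (e ∷ p) → Pre C p
  Pre-tail (B , R∈C) = _ ∷ B , R∈C

  Pre-drop : ∀ {C} M {p} → Pre C (M ++ p) → Pre C p
  Pre-drop []      h = h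
  Pre-drop (e ∷ M) h = Pre-drop M (Pre-tail h)

  AnyPrefix⇒Pre : ∀ {C P} → Any (Prefix _≡_ P) C → Pre C (reverse P)
  AnyPrefix⇒Pre {C} {P} h with find h
  ... | R , R∈C , π with Prefix⇒++ π
  ...   | B , refl = B , subst (_∈ C) (sym (reverse-ʳ++ P)) R∈C

  Pre⇒AnyPrefix : ∀ {C P} → Pre C (reverse P) → Any (Prefix _≡_ P) C
  Pre⇒AnyPrefix {C} {P} (B , R∈C) = lose (subst (_∈ C) (reverse-ʳ++ P) R∈C) (++⇒Prefix P)

  Pre? : ∀ C p → Dec (Pre C p)
  Pre? C p = map′ (subst (Pre C) (reverse-involutive p) ∘ AnyPrefix⇒Pre {P = reverse p})
                  (Pre⇒AnyPrefix ∘ subst (Pre C) (sym (reverse-involutive p)))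
                  (any? (prefix? _≟ᵉ_ (reverse p)) C)

  Pre⇒∈concatMap : ∀ {C P} → Pre C (reverse P) → P ∈ concatMap inits C
  Pre⇒∈concatMap {C} {P} (B , R∈C) =
    ∈-concatMap⁺ inits (lose R∈C (subst (λ R → P ∈ inits R) (sym (reverse-ʳ++ P)) (∈-inits⁺ P)))

  ∈-prefixesBefore⁻ : ∀ {C} {e : Edge n} {P} → P ∈ prefixesBefore C e → Pre C (e ∷ reverse P)
  ∈-prefixesBefore⁻ {C} {e} {P} P∈ =
    subst (Pre C) (reverse-++ P [ e ]) (AnyPrefix⇒Pre
      (proj₂ (∈-filter⁻ (λ P → any? (prefix? _≟ᵉ_ (P ++ [ e ])) C) {xs = concatMap inits C}
        (∈-deduplicate⁻ (≡-dec _≟ᵉ_) (filter (λ P → any? (prefix? _≟ᵉ_ (P ++ [ e ])) C) (concatMap inits C)) P∈))))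

  ∈-prefixesBefore⁺ : ∀ {C} {e : Edge n} {P} → Pre C (e ∷ reverse P) → P ∈ prefixesBefore C e
  ∈-prefixesBefore⁺ {C} {e} {P} h =
    ∈-deduplicate⁺ (≡-dec _≟ᵉ_) (∈-filter⁺ (λ P → any? (prefix? _≟ᵉ_ (P ++ [ e ])) C)
      (Pre⇒∈concatMap (Pre-tail h)) (Pre⇒AnyPrefix (subst (Pre C) (sym (reverse-++ P [ e ])) h)))

  prefixesBefore-unique : ∀ C (e : Edge n) → Unique (prefixesBefore C e)
  prefixesBefore-unique C e = deduplicate-! (≡-dec _≟ᵉ_) _

  prefixes : List (Path n) → List (Path n)
  prefixes C = map reverse (concatMap inits C)

  Pre⇒∈prefixes : ∀ {C p} → Pre C p → p ∈ prefixes C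
  Pre⇒∈prefixes {C} {p} h =
    subst (_∈ prefixes C) (reverse-involutive p)
      (∈-map⁺ reverse (Pre⇒∈concatMap {P = reverse p} (subst (Pre C) (sym (reverse-involutive p)) h)))

-- Paths in the zigzag graph.

module Zigzag {n : ℕ} (3≤n : 3 ≤ n) where

  source<target : ∀ (e : Edge n) → source e < target e
  source<target (edge (x i) _)       = ≤-refl
  source<target (edge (y zero) _)    = ⊓-glb (≤-trans (n≤1+n 2) 3≤n) ≤-refl
  source<target (edge (y (suc i)) h) = ⊓-glb (recompute (isEdge? (y (suc i))) h) (n≤1+n _)

  source<n : ∀ (e : Edge n) → source e < n
  source<n e = <-≤-trans (source<target e) (target≤n e)

  2≤target : ∀ (e : Edge n) → 2 ≤ target e
  2≤target e = ≤-trans (s≤s (1≤source e)) (source<target e)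

  1≤end : ∀ (p : Path n) → 1 ≤ end p
  1≤end []      = ≤-refl
  1≤end (e ∷ _) = ≤-trans (n≤1+n 1) (2≤target e)

  Chain-drop : ∀ M {p : Path n} → Chain (M ++ p) → Chain p
  Chain-drop []      ch       = ch
  Chain-drop (_ ∷ M) (_ , ch) = Chain-drop M ch

  end≤n : ∀ (p : Path n) → end p ≤ n
  end≤n []      = ≤-trans (s≤s z≤n) 3≤n
  end≤n (e ∷ _) = target≤n e

  end-mono : ∀ M {p : Path n} → Chain (M ++ p) → end p ≤ end (M ++ p)
  end-mono []      _         = ≤-refl
  end-mono (e ∷ M) (eq , ch) =
    ≤-trans (end-mono M ch) (<⇒≤ (subst (_< target e) eq (source<target e)))

  end-mono-< : ∀ e M {p : Path n} → Chain (e ∷ M ++ p) → end p < target e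
  end-mono-< e M (eq , ch) = ≤-<-trans (end-mono M ch) (subst (_< target e) eq (source<target e))

  split : ∀ (p : Path n) {B} → IsRoute (p ʳ++ B) → Chain p × IsPath (end p) B n
  split []      h = tt , h
  split (e ∷ p) h with split p h
  ... | ch , eq , h′ = (eq , ch) , h′

  join : ∀ (p : Path n) {B} → Chain p → IsPath (end p) B n → IsRoute (p ʳ++ B)
  join []      _         h = h
  join (e ∷ p) (eq , ch) h = join p ch (eq , h)

  IsPath-source≥ : ∀ {i j} B → IsPath {n} i B j → ∀ {e} → e ∈ B → i ≤ source e
  IsPath-source≥ (e ∷ B) (refl , _) (here refl) = ≤-refl
  IsPath-source≥ (e ∷ B) (refl , h) (there e∈)  =
    ≤-trans (<⇒≤ (source<target e)) (IsPath-source≥ B h e∈)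

  -- Every edge raises the vertex number, so of two nested prefixes the longer one ends strictly
  -- later.
  end-injective : ∀ (p q : Path n) {B B′} → IsRoute (p ʳ++ B) → p ʳ++ B ≡ q ʳ++ B′ →
    end p ≡ end q → p ≡ q
  end-injective p q h eq ends
    with ʳ++-comparable p q eq | proj₁ (split p h) | proj₁ (split q (subst IsRoute eq h))
  ... | inj₁ ([]    , refl) | _   | _   = refl
  ... | inj₁ (e ∷ M , refl) | chp | _   = contradiction (sym ends) (<⇒≢ (end-mono-< e M chp))
  ... | inj₂ ([]    , refl) | _   | _   = refl
  ... | inj₂ (e ∷ M , refl) | _   | chq = contradiction ends (<⇒≢ (end-mono-< e M chq))

  -- Two edges into a vertex below `n` with different slackness decide the comparison at once; with
  -- equal slackness they coincide, and the prefixes before them again end at a common vertex below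
  -- `n`.
  ⊏-total : ∀ (p q : Path n) → Chain p → Chain q → end p ≡ end q → end p < n → p ≼ q ⊎ q ⊏ p
  ⊏-total []      []      _ _ _  _ = inj₁ (inj₁ refl)
  ⊏-total []      (f ∷ q) _ _ eq _ = contradiction (subst (2 ≤_) (sym eq) (2≤target f)) λ { (s≤s ()) }
  ⊏-total (e ∷ p) []      _ _ eq _ = contradiction (subst (2 ≤_) eq (2≤target e)) λ { (s≤s ()) }
  ⊏-total (e ∷ p) (f ∷ q) (e₁ , chp) (f₁ , chq) eq lt with slack e ≟ᵇ slack f
  ... | yes s
    with refl ← target-slack-injective {e = e} {f} lt eq s
    with ⊏-total p q chp chq (trans (sym e₁) f₁) (subst (_< n) e₁ (source<n e))
  ...   | inj₁ (inj₁ refl) = inj₁ (inj₁ refl)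
  ...   | inj₁ (inj₂ p⊏q)  = inj₁ (inj₂ (there p⊏q))
  ...   | inj₂ q⊏p         = inj₂ (there q⊏p)
  ⊏-total (e ∷ p) (f ∷ q) _ _ _ _ | no ¬s with slack e in se | slack f in sf
  ... | false | true  = inj₁ (inj₂ (here se sf))
  ... | true  | false = inj₂ (here sf se)
  ... | true  | true  = contradiction refl ¬s
  ... | false | false = contradiction refl ¬s

  -- Conflicts as crossings.

  ⊏⇒≺ᵖ : ∀ {p q : Path n} → Chain p → Chain q → end p ≡ end q → end p < n →
    p ⊏ q → reverse p ≺ᵖ reverse q
  ⊏⇒≺ᵖ _ _ eq lt (here {e} {f} {p} {q} a b) =
    reverse p , e , reverse q , f , [] , unfold-reverse e p , unfold-reverse f q ,
    slack⇒≺ⁱⁿ eq lt a b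
  ⊏⇒≺ᵖ (e₁ , chp) (f₁ , chq) _ _ (there {e} {p} {q} p⊏q)
    with ⊏⇒≺ᵖ chp chq (trans (sym e₁) f₁) (subst (_< n) e₁ (source<n e)) p⊏q
  ... | A , g , A′ , g′ , S , eq , eq′ , g≺g′ =
    A , g , A′ , g′ , S ++ [ e ] , snoc p A g eq , snoc q A′ g′ eq′ , g≺g′
    where
    snoc : ∀ p A g → reverse p ≡ A ++ g ∷ S → reverse (e ∷ p) ≡ A ++ g ∷ S ++ [ e ]
    snoc p A g eq = trans (unfold-reverse e p) (trans (cong (_++ [ e ]) eq) (++-assoc A (g ∷ S) [ e ]))

  splitsAt : ∀ (p : Path n) {Q} → IsRoute (p ʳ++ Q) → SplitsAt (end p) (p ʳ++ Q) (reverse p) Q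
  splitsAt p h with split p h
  ... | ch , hQ = ʳ++-defn p , go p ch refl , hQ
    where
    go : ∀ (p : Path n) {i B} → Chain p → IsPath (end p) B i → IsPath 1 (p ʳ++ B) i
    go []      _         h = h
    go (e ∷ p) (eq , ch) h = go p ch (eq , h)

  crossing⇒conflict : ∀ {p q e f} {B B′ : Path n} →
    IsRoute (p ʳ++ e ∷ B) → IsRoute (q ʳ++ f ∷ B′) → end p ≡ end q →
    slack e ≡ false → slack f ≡ true → p ⊏ q →
    ConflictAt (end p) (p ʳ++ e ∷ B) (q ʳ++ f ∷ B′)
  crossing⇒conflict {p} {q} {e} {f} {B} {B′} r r′ eq a b p⊏q with split p r | split q r′
  ... | chp , e₁ , _ | chq , f₁ , _ =
    (2≤end , end<n) , reverse p , e ∷ B , reverse q , f ∷ B′ , splitsAt p r ,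
    subst (λ i → SplitsAt i _ _ _) (sym eq) (splitsAt q r′) ,
    inj₁ (⊏⇒≺ᵖ chp chq eq end<n p⊏q ,
          [] , f , B′ , e , B , refl , refl , slack⇒≺ᵒᵘᵗ (trans f₁ (trans (sym eq) (sym e₁)))
            (subst (2 ≤_) (trans eq (sym f₁)) 2≤end) b a)
    where
    end<n : end p < n
    end<n = subst (_< n) e₁ (source<n e)
    -- The empty prefix is not below anything, so `p` has a last edge and the crossing is not at
    -- vertex 1.
    2≤end : 2 ≤ end p
    2≤end with g , _ , refl ← ⊏⇒∷ p⊏q = 2≤target g

  -- The suffixes may share a stretch `S` beyond the vertex of conflict. Appending `S` to both
  -- prefixes preserves their order and moves the conflict to the vertex where the routes separate.
  conflict⇒crossing : ∀ {i} {R R′ : Path n} → IsRoute R → IsRoute R′ → ConflictAt i R R′ →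
    ∃[ p ] ∃[ e ] ∃[ B ] ∃[ q ] ∃[ f ] ∃[ B′ ]
      R ≡ p ʳ++ e ∷ B × R′ ≡ q ʳ++ f ∷ B′ × end p ≡ end q × Crossing e p f q
  conflict⇒crossing {i} r r′ (_ , P , Q , P′ , Q′ , (refl , _) , (refl , _) , opposed) = cases opposed
    where
    route-eq : ∀ P S e B → P ++ S ++ e ∷ B ≡ (S ʳ++ reverse P) ʳ++ e ∷ B
    route-eq P S e B = sym (trans (ʳ++-ʳ++ S) (reverse-ʳ++ P))

    reverse-⊏ : ∀ {P P′} → P ≺ᵖ P′ → reverse P ⊏ reverse P′
    reverse-⊏ (A , e , A′ , e′ , S , refl , refl , e≺e′) =
      subst₂ _⊏_ (sym (++-ʳ++ A)) (sym (++-ʳ++ A′))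
        (⊏-ʳ++ S (here (proj₁ (≺ⁱⁿ⇒slack {e = e} {e′} e≺e′)) (proj₂ (≺ⁱⁿ⇒slack {e = e} {e′} e≺e′))))

    go : ∀ {P Q P′ Q′ : Path n} → IsRoute (P ++ Q) → IsRoute (P′ ++ Q′) → P ≺ᵖ P′ → Q′ ≺ˢ Q →
      ∃[ p ] ∃[ e ] ∃[ B ] ∃[ q ] ∃[ f ] ∃[ B′ ]
        P ++ Q ≡ p ʳ++ e ∷ B × P′ ++ Q′ ≡ q ʳ++ f ∷ B′ × end p ≡ end q × Crossing e p f q
    go {P} {P′ = P′} r r′ P≺P′ (S , f , B′ , e , B , refl , refl , f≺e)
      with ≺ᵒᵘᵗ⇒slack {e = f} {e} f≺e
         | split (S ʳ++ reverse P) (subst IsRoute (route-eq P S e B) r)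
         | split (S ʳ++ reverse P′) (subst IsRoute (route-eq P′ S f B′) r′)
    ... | sources , sf , se | _ , e₁ , _ | _ , f₁ , _ =
      S ʳ++ reverse P , e , B , S ʳ++ reverse P′ , f , B′ , route-eq P S e B , route-eq P′ S f B′ ,
      trans (sym e₁) (trans (sym sources) f₁) , crossing se sf (⊏-ʳ++ S (reverse-⊏ P≺P′))

    cases : (P ≺ᵖ P′ × Q′ ≺ˢ Q) ⊎ (P′ ≺ᵖ P × Q ≺ˢ Q′) →
      ∃[ p ] ∃[ e ] ∃[ B ] ∃[ q ] ∃[ f ] ∃[ B′ ]
        P ++ Q ≡ p ʳ++ e ∷ B × P′ ++ Q′ ≡ q ʳ++ f ∷ B′ × end p ≡ end q × Crossing e p f q
    cases (inj₁ (P≺P′ , Q′≺Q)) = go r r′ P≺P′ Q′≺Q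
    cases (inj₂ (P′≺P , Q≺Q′)) with go r′ r P′≺P Q≺Q′
    ... | q , f , B′ , p , e , B , eq′ , eq , ends , cr =
      p , e , B , q , f , B′ , eq , eq′ , sym ends , Crossing-sym cr

  -- Side s c p: a prefix p may precede an edge of slackness s where c is the cut.
  Side : Bool → Rel (Path n) 0ℓ
  Side true  c p = p ≼ c
  Side false c p = c ≼ p

  Side-trans : ∀ s {p q r} → Side s p q → Side s q r → Side s p r
  Side-trans true  pq qr = ≼-trans qr pq
  Side-trans false pq qr = ≼-trans pq qr

  Side-antisym : ∀ s {p q} → Side s p q → Side s q p → p ≡ q
  Side-antisym true  pq qp = ≼-antisym qp pq
  Side-antisym false pq qp = ≼-antisym pq qp

  Side-opposite : ∀ s {p q} → Side s p q → Side (not s) p q → p ≡ q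
  Side-opposite true  qp pq = ≼-antisym pq qp
  Side-opposite false pq qp = ≼-antisym pq qp

  Side-∷ : ∀ s {e p q} → Side s p q → Side s (e ∷ p) (e ∷ q)
  Side-∷ true  (inj₁ refl) = inj₁ refl
  Side-∷ true  (inj₂ q⊏p)  = inj₂ (there q⊏p)
  Side-∷ false (inj₁ refl) = inj₁ refl
  Side-∷ false (inj₂ p⊏q)  = inj₂ (there p⊏q)

  Side-opposite-slack : ∀ s {e g p q} → slack e ≡ s → slack g ≡ not s → Side s (e ∷ p) (g ∷ q)
  Side-opposite-slack true  a b = inj₂ (here b a)
  Side-opposite-slack false a b = inj₂ (here a b)

  Side-or-Beyond : ∀ s {p q} → Chain p → Chain q → end p ≡ end q → end p < n →
    Side s p q ⊎ Beyond s q p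
  Side-or-Beyond false {p} {q} chp chq eq lt = ⊏-total p q chp chq eq lt
  Side-or-Beyond true  {p} {q} chp chq eq lt = ⊏-total q p chq chp (sym eq) (subst (_< n) eq lt)

  -- Compatible paths and maximality.

  Ok : List (Path n) → Edge n → Path n → Set
  Ok C e p = ∀ {f q} → Pre C (f ∷ q) → end p ≡ end q → ¬ Crossing e p f q

  -- Absence of conflict with `C`, imposed edge by edge, so that it can be maintained while a path
  -- grows.
  Compatible : List (Path n) → Path n → Set
  Compatible C []      = ⊤
  Compatible C (e ∷ p) = Ok C e p × Compatible C p

  Compatible-drop : ∀ {C} M {p} → Compatible C (M ++ p) → Compatible C p
  Compatible-drop []      c       = c
  Compatible-drop (_ ∷ M) (_ , c) = Compatible-drop M c

  Compatible-ʳ++ : ∀ {C} (p : Path n) {B} → Compatible C (B ʳ++ p) → Compatible C p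
  Compatible-ʳ++ {C} p {B} c = Compatible-drop (reverse B) (subst (Compatible C) (ʳ++-defn B) c)

  module _ {C : List (Path n)} (isClique : IsClique C) where
    open IsClique isClique

    Pre⇒Chain : ∀ {p} → Pre C p → Chain p
    Pre⇒Chain {p} (B , R∈C) = proj₁ (split p (routes R∈C))

    source-Pre : ∀ {e p} → Pre C (e ∷ p) → source e ≡ end p
    source-Pre h = proj₁ (Pre⇒Chain h)

    noCrossing : ∀ {e p f q} → Pre C (e ∷ p) → Pre C (f ∷ q) → end p ≡ end q → ¬ Crossing e p f q
    noCrossing {e} (B , R∈C) (B′ , R′∈C) eq (opp , bey) with slack e in se
    ... | false = nonconflict R∈C R′∈C _ (crossing⇒conflict (routes R∈C) (routes R′∈C) eq se opp bey)
    ... | true  = nonconflict R′∈C R∈C _ (crossing⇒conflict (routes R′∈C) (routes R∈C) (sym eq) opp se bey)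

    Pre-extend : ∀ {p} → Pre C p → end p < n → ∃[ e ] source e ≡ end p × Pre C (e ∷ p)
    Pre-extend {p} ([]    , R∈C) lt = contradiction (proj₂ (split p (routes R∈C))) (<⇒≢ lt)
    Pre-extend {p} (e ∷ B , R∈C) lt = e , proj₁ (proj₂ (split p (routes R∈C))) , (B , R∈C)

  module _ {C : List (Path n)} (isMax : IsMaximalClique C) where
    open IsMaximalClique isMax
    open IsClique isClique

    Pre⇒Compatible : ∀ p → Pre C p → Compatible C p
    Pre⇒Compatible []      _ = tt
    Pre⇒Compatible (e ∷ p) h = noCrossing isClique h , Pre⇒Compatible p (Pre-tail h)

    -- Were both edges leaving end p forbidden, the routes forbidding them
    -- would conflict with each other.
    extend : ∀ {p} → 2 ≤ end p → end p < n → ∃[ e ] source e ≡ end p × Ok C e p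
    extend {p} 2≤ <n with any? (λ q → Pre? C (out false 1≤ <n ∷ q) ×-dec (q ⊏? p)) (prefixes C)
      where 1≤ = 1≤end p
    ... | yes found with find found
    ...   | q , _ , hq , q⊏p = outʸ , source-out false 1≤ <n , ok
      where
      1≤ = 1≤end p
      outʸ = out false 1≤ <n
      ok : Ok C outʸ p
      ok hf ends (sf , p⊏q′) =
        noCrossing isClique hq hf
          (trans (sym (source-Pre isClique hq)) (trans (source-out false 1≤ <n) ends))
          (crossing refl sf (⊏-trans q⊏p p⊏q′))
    extend {p} 2≤ <n | no none = out true 1≤ <n , refl , ok
      where
      1≤ = 1≤end p
      ok : Ok C (out true 1≤ <n) p
      ok {f} hf ends (sf , q⊏p) = none (lose (Pre⇒∈prefixes (Pre-tail hf))
        (subst (λ f → Pre C (f ∷ _)) f≡ hf , q⊏p))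
        where
        sources : source f ≡ end p
        sources = trans (source-Pre isClique hf) (sym ends)
        f≡ : f ≡ out false 1≤ <n
        f≡ = source-slack-injective (subst (2 ≤_) (sym sources) 2≤)
               (trans sources (sym (source-out false 1≤ <n))) sf

    -- Adjoining the route to `C` leaves a clique. A conflict with a member of `C` would be a
    -- crossing at some edge of the route, which `Compatible` forbids; a conflict of the route with
    -- itself would need two different prefixes of it at one vertex.
    compatible-route : ∀ p → Chain p → end p ≡ n → Compatible C p → p ʳ++ [] ∈ C
    compatible-route p ch end≡n comp = maximal (R ∷ C) clique+ there (here refl)
      where
      R = p ʳ++ []
      route : IsRoute R
      route = join p ch end≡n

      new : ∀ {i S} → S ∈ C → ¬ ConflictAt i R S
      new S∈C cf with conflict⇒crossing route (routes S∈C) cf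
      ... | p₁ , e , B , q , f , B′ , eq , refl , ends , cr =
        proj₁ (Compatible-ʳ++ (e ∷ p₁) {B} (subst (Compatible C) (ʳ++-flip p (e ∷ p₁) eq) comp))
          (B′ , S∈C) ends cr

      self : ∀ {i} → ¬ ConflictAt i R R
      self cf with conflict⇒crossing route route cf
      ... | p₁ , e , B , q , f , B′ , eq , eq′ , ends , cr
        with refl ← end-injective p₁ q (subst IsRoute eq route) (trans (sym eq) eq′) ends =
        Crossing-irrefl cr

      new′ : ∀ {i S} → S ∈ C → ¬ ConflictAt i S R
      new′ S∈C cf with conflict⇒crossing (routes S∈C) route cf
      ... | q , f , B′ , p₁ , e , B , refl , eq , ends , cr =
        proj₁ (Compatible-ʳ++ (e ∷ p₁) {B} (subst (Compatible C) (ʳ++-flip p (e ∷ p₁) eq) comp))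
          (B′ , S∈C) (sym ends) (Crossing-sym cr)

      clique+ : IsClique (R ∷ C)
      clique+ = record
        { routes      = λ { (here refl) → route ; (there S∈C) → routes S∈C }
        ; nonconflict = λ { (here refl) (here refl) _ → self
                          ; (here refl) (there S∈C) _ → new S∈C
                          ; (there S∈C) (here refl) _ → new′ S∈C
                          ; (there S∈C) (there T∈C) → nonconflict S∈C T∈C } }

    -- `extend` is applied until vertex `n` is reached; the complete route lies in `C`, and so `p`
    -- occurs in it. The number `k` bounds the remaining steps, as each edge raises `end p`.
    Compatible⇒Pre : ∀ k p → n ≤ k + end p → Chain p → 2 ≤ end p → Compatible C p → Pre C p
    Compatible⇒Pre k p n≤ ch 2≤ comp with <-cmp (end p) n
    ... | tri≈ _ end≡n _ = [] , compatible-route p ch end≡n comp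
    Compatible⇒Pre k p n≤ ch 2≤ comp | tri> _ _ n<end = contradiction n<end (≤⇒≯ (end≤n p))
    Compatible⇒Pre zero p n≤ ch 2≤ comp | tri< end<n _ _ = contradiction end<n (≤⇒≯ n≤)
    Compatible⇒Pre (suc k) p n≤ ch 2≤ comp | tri< end<n _ _ with extend 2≤ end<n
    ... | e , e₁ , ok = Pre-tail (Compatible⇒Pre k (e ∷ p)
            (≤-trans n≤ (≤-trans (≤-reflexive (sym (+-suc k (end p))))
              (+-monoʳ-≤ k (subst (_< target e) e₁ (source<target e)))))
            (e₁ , ch) (2≤target e) (ok , comp))

    Ok⇒Pre : ∀ {e p} → Chain (e ∷ p) → Compatible C p → Ok C e p → Pre C (e ∷ p)
    Ok⇒Pre {e} ch comp ok = Compatible⇒Pre n (e ∷ _) (m≤m+n n _) ch (2≤target e) (ok , comp)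

    -- Only the empty prefix ends at vertex 1, so nothing can cross there. All maximal cliques
    -- therefore agree on the edges leaving vertex 1.
    initial : ∀ {e} → source e ≡ 1 → Pre C (e ∷ [])
    initial {e} e₁ = Ok⇒Pre (e₁ , tt) tt ok
      where
      ok : Ok C e []
      ok {q = []}    _ _    = Crossing-irrefl
      ok {q = g ∷ _} _ ends = contradiction (subst (2 ≤_) (sym ends) (2≤target g)) λ { (s≤s ()) }

  -- Cuts.

  record IsCut (C : List (Path n)) (j : ℕ) (c : Path n) : Set where
    field
      end≡     : end c ≡ j
      followed : ∀ {e} → source e ≡ j → Pre C (e ∷ c)

  IsCut⇒Pre : ∀ {C j c} → IsCut C j c → 1 ≤ j → j < n → Pre C c
  IsCut⇒Pre isCut 1≤j j<n = Pre-tail (IsCut.followed isCut {e = out true 1≤j j<n} (source-out true 1≤j j<n))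

  module _ {C : List (Path n)} (isMax : IsMaximalClique C) where
    open IsMaximalClique isMax

    AtPre : ℕ → Path n → Set
    AtPre j p = end p ≡ j × Pre C p

    Side-total : ∀ s {j p q} → j < n → AtPre j p → AtPre j q → Side s p q ⊎ Side s q p
    Side-total s {p = p} {q} j<n (refl , hp) (end-q , hq)
      with ⊏-total p q (Pre⇒Chain isClique hp) (Pre⇒Chain isClique hq) (sym end-q) j<n | s
    ... | inj₁ p≼q | true  = inj₂ p≼q
    ... | inj₁ p≼q | false = inj₁ p≼q
    ... | inj₂ q⊏p | true  = inj₁ (inj₂ q⊏p)
    ... | inj₂ q⊏p | false = inj₂ (inj₂ q⊏p)

    -- Serves both directions: `false` selects the lowest prefix with the property, `true` the
    -- highest.
    extremal : ∀ s {j} {P : Path n → Set} → j < n → (∀ p → Dec (P p)) → (∀ {p} → P p → AtPre j p) →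
      ∀ {p} → P p → ∃[ m ] P m × (∀ {q} → P q → Side s m q)
    extremal s {P = P} j<n P? at {p} hp
      with least {_≤′_ = Side s} P (Side-trans s) (λ u v → Side-total s j<n (at u) (at v))
             (∈-filter⁺ P? (Pre⇒∈prefixes (proj₂ (at hp))) hp)
             (All.tabulate (proj₂ ∘ ∈-filter⁻ P? {xs = prefixes C}))
    ... | m , m∈ , m≤ =
      m , proj₂ (∈-filter⁻ P? {xs = prefixes C} m∈) ,
      λ hq → m≤ (∈-filter⁺ P? (Pre⇒∈prefixes (proj₂ (at hq))) hq)

    Ok⇒Pre-out : ∀ s {j p} (1≤j : 1 ≤ j) (j<n : j < n) → AtPre j p → Ok C (out s 1≤j j<n) p →
      Pre C (out s 1≤j j<n ∷ p)
    Ok⇒Pre-out s 1≤j j<n (end-p , h) ok =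
      Ok⇒Pre isMax (trans (source-out s 1≤j j<n) (sym end-p) , Pre⇒Chain isClique h) (Pre⇒Compatible isMax _ h) ok

    out-unique : ∀ s {j} (2≤j : 2 ≤ j) (1≤j : 1 ≤ j) (j<n : j < n) {f} → source f ≡ j → slack f ≡ s →
      f ≡ out s 1≤j j<n
    out-unique s 2≤j 1≤j j<n f₁ sf = source-slack-injective (subst (2 ≤_) (sym f₁) 2≤j)
      (trans f₁ (sym (source-out s 1≤j j<n))) (trans sf (sym (slack-out s 1≤j j<n)))

    -- The lowest prefix may be continued by the slack edge, and the highest
    -- prefix so continued may also be continued by the nonslack edge.
    module _ {j} (2≤j : 2 ≤ j) (1≤j : 1 ≤ j) (j<n : j < n) where

      xⱼ yⱼ : Edge n
      xⱼ = out true  1≤j j<n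
      yⱼ = out false 1≤j j<n

      Slack : Path n → Set
      Slack p = end p ≡ j × Pre C (xⱼ ∷ p)

      someSlack : ∀ {p} → AtPre j p → ∃[ m ] Slack m
      someSlack at = m , proj₁ m-at , Ok⇒Pre-out true 1≤j j<n m-at ok
        where
        lowest : ∃[ m ] AtPre j m × (∀ {q} → AtPre j q → m ≼ q)
        lowest = extremal false j<n (λ p → (end p ≟ j) ×-dec Pre? C p) (λ h → h) at
        m = proj₁ lowest
        m-at = proj₁ (proj₂ lowest)
        ok : Ok C xⱼ m
        ok hf ends (_ , q⊏m) = ≼⇒⊐̸ (proj₂ (proj₂ lowest) (trans (sym ends) (proj₁ m-at) , Pre-tail hf)) q⊏m

      highestSlack : ∀ {m} → Slack m → ∃[ c ] Slack c × (∀ {q} → Slack q → q ≼ c)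
      highestSlack = extremal true j<n (λ p → (end p ≟ j) ×-dec Pre? C (xⱼ ∷ p))
        (λ (end-p , h) → end-p , Pre-tail h)

      highestSlack⇒cut : ∀ {c} → Slack c → (∀ {q} → Slack q → q ≼ c) → IsCut C j c
      highestSlack⇒cut {c} (end-c , xc) ≼c = record { end≡ = end-c ; followed = followed }
        where
        ok : Ok C yⱼ c
        ok {f} {q} hf ends (sf , c⊏q) = ≼⇒⊐̸ (≼c (end-q , xq)) c⊏q
          where
          end-q : end q ≡ j
          end-q = trans (sym ends) end-c
          xq : Pre C (xⱼ ∷ q)
          xq = subst (λ f → Pre C (f ∷ q)) (out-unique true 2≤j 1≤j j<n (trans (source-Pre isClique hf) end-q) sf) hf

        yc : Pre C (yⱼ ∷ c)
        yc = Ok⇒Pre-out false 1≤j j<n (end-c , Pre-tail xc) ok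

        followed : ∀ {e} → source e ≡ j → Pre C (e ∷ c)
        followed {e} e₁ = cases (slack e) refl
          where
          cases : ∀ s → slack e ≡ s → Pre C (e ∷ c)
          cases true  se = subst (λ e → Pre C (e ∷ c)) (sym (out-unique true 2≤j 1≤j j<n e₁ se)) xc
          cases false se = subst (λ e → Pre C (e ∷ c)) (sym (out-unique false 2≤j 1≤j j<n e₁ se)) yc

      inhabited⇒cut : ∀ {p} → AtPre j p → ∃[ c ] IsCut C j c
      inhabited⇒cut at =
        let m , m-slack      = someSlack at
            c , c-slack , ≼c = highestSlack m-slack
        in c , highestSlack⇒cut c-slack ≼c

    -- The slack edge after a cut reaches the next vertex, so each cut provides the prefix from
    -- which the next one is obtained.
    inhabited : ∀ i → 2 + i < n → ∃[ p ] AtPre (2 + i) p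
    inhabited zero    2<n = out true ≤-refl (<-trans (n<1+n 1) 2<n) ∷ [] , refl , initial isMax refl
    inhabited (suc i) i<n =
      let c , isCut = inhabited⇒cut (s≤s (s≤s z≤n)) (s≤s z≤n) (<⇒≤ i<n) (proj₂ (inhabited i (<⇒≤ i<n)))
      in out true (s≤s z≤n) (<⇒≤ i<n) ∷ c , refl , IsCut.followed isCut refl

    abstract
      cut : ∀ {j} → 2 ≤ j → j < n → ∃[ c ] IsCut C j c
      cut (s≤s (s≤s {n = i} z≤n)) j<n =
        inhabited⇒cut (s≤s (s≤s z≤n)) (s≤s z≤n) j<n (proj₂ (inhabited i j<n))

    -- The cut is also followed by the edge of the other slackness, which a prefix on the wrong side
    -- would cross.
    Pre⇒Side : ∀ {j c e p} → IsCut C j c → j < n → Pre C (e ∷ p) → end p ≡ j → Side (slack e) c p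
    Pre⇒Side {c = c} {e} {p} isCut j<n h refl =
      [ id , ⊥-elim ∘ crossesCut ]′
        (Side-or-Beyond (slack e) (Pre⇒Chain isClique (Pre-tail g-c)) (Pre⇒Chain isClique (Pre-tail h))
          end≡ (subst (_< n) (sym end≡) j<n))
      where
      open IsCut isCut
      1≤ = 1≤end p
      g-c : Pre C (out (not (slack e)) 1≤ j<n ∷ c)
      g-c = followed (source-out (not (slack e)) 1≤ j<n)
      crossesCut : ¬ Beyond (slack e) p c
      crossesCut beyond = noCrossing isClique h g-c (sym end≡) (slack-out (not (slack e)) 1≤ j<n , beyond)

    -- The prefix has some continuation in `C`. If its slackness is not that of `e`, then `Pre⇒Side`
    -- puts `p` on the other side of the cut as well, so `p` is the cut and is followed by both
    -- edges.
    Side⇒Pre : ∀ {j c e p} → IsCut C j c → 2 ≤ j → j < n → AtPre j p → source e ≡ j →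
      Side (slack e) c p → Pre C (e ∷ p)
    Side⇒Pre {j} {c} {e} {p} isCut 2≤j j<n (end-p , h) e₁ side
      with Pre-extend isClique h (subst (_< n) (sym end-p) j<n)
    ... | f , f₁ , hf = cases (slack f ≟ᵇ slack e)
      where
      open IsCut isCut
      cases : Dec (slack f ≡ slack e) → Pre C (e ∷ p)
      cases (yes eq) = subst (λ e → Pre C (e ∷ p))
        (source-slack-injective (subst (2 ≤_) (sym (trans f₁ end-p)) 2≤j) (trans (trans f₁ end-p) (sym e₁)) eq) hf
      cases (no ≢) = subst (λ p → Pre C (e ∷ p))
        (Side-opposite (slack e) side (subst (λ s → Side s c p) (¬-not ≢) (Pre⇒Side isCut j<n hf end-p)))
        (followed e₁)

    -- Prefixes arriving along `e` are ordered as they were before it, where `c` is the extreme one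
    -- followed by `e`. Those arriving along the other edge lie on the required side by the incoming
    -- order. Thus `e ∷ c` is lowest for nonslack `e` and highest for slack `e`.
    cut-extremal : ∀ {j c e} → IsCut C j c → 2 ≤ j → source e ≡ j → target e < n →
      ∀ {q} → Pre C q → end q ≡ target e → Side (slack e) (e ∷ c) q
    cut-extremal {e = e} isCut 2≤j e₁ lt {[]} h eq = contradiction (subst (2 ≤_) (sym eq) (2≤target e)) λ { (s≤s ()) }
    cut-extremal {j} {c} {e} isCut 2≤j e₁ lt {g ∷ q} h eq = cases (slack g ≟ᵇ slack e)
      where
      cases : Dec (slack g ≡ slack e) → Side (slack e) (e ∷ c) (g ∷ q)
      cases (yes s) with refl ← target-slack-injective {e = e} {g} lt (sym eq) (sym s) =
        Side-∷ (slack e) (Pre⇒Side isCut (subst (_< n) e₁ (source<n e)) h (trans (sym (source-Pre isClique h)) e₁))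
      cases (no ≢) = Side-opposite-slack (slack e) refl (¬-not ≢)

-- Prefixes occurring in only one of two cliques.

module Flip {n : ℕ} (3≤n : 3 ≤ n) {C C′ : List (Path n)}
  (isMax : IsMaximalClique C) {R : Path n} (route : IsRoute R)
  (only : ∀ {T} → T ∈ C → T ∉ C′ → T ≡ R) where

  open Zigzag 3≤n
  open IsMaximalClique isMax

  New : Path n → Set
  New p = Pre C p × ¬ Pre C′ p

  New⇒prefix : ∀ {p} → New p → ∃[ B ] R ≡ p ʳ++ B
  New⇒prefix ((B , T∈C) , ¬h) = B , sym (only T∈C (λ T∈C′ → ¬h (B , T∈C′)))

  New-∷ : ∀ {e p} → New p → Pre C (e ∷ p) → New (e ∷ p)
  New-∷ (_ , ¬h) he = he , ¬h ∘ Pre-tail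

  New-end-injective : ∀ p q {B B′} → R ≡ p ʳ++ B → R ≡ q ʳ++ B′ → end p ≡ end q → p ≡ q
  New-end-injective p q eq eq′ = end-injective p q (subst IsRoute eq route) (trans (sym eq) eq′)

  New-next-unique : ∀ {e f p} → New p → Pre C (e ∷ p) → Pre C (f ∷ p) → e ≡ f
  New-next-unique {p = p} new he hf
    with New⇒prefix (New-∷ new he) | New⇒prefix (New-∷ new hf)
  ... | _ , eq | _ , eq′ = ∷-injectiveˡ (ʳ++-cancelˡ p (trans (sym eq) eq′))

  New≢cut : ∀ {j p c} → 1 ≤ j → j < n → New p → IsCut C j c → p ≢ c
  New≢cut 1≤j j<n new isCut refl =
    contradiction (trans (sym (slack-out true 1≤j j<n))
                    (trans (cong slack (New-next-unique new (f true) (f false))) (slack-out false 1≤j j<n))) λ ()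
    where
    f : ∀ s → Pre C (out s 1≤j j<n ∷ _)
    f s = IsCut.followed isCut (source-out s 1≤j j<n)

  New-at-end : ∀ p {B} → R ≡ p ʳ++ B → end p ≡ n → B ≡ []
  New-at-end p {[]}    _    _     = refl
  New-at-end p {e ∷ B} refl end≡n =
    contradiction (trans (proj₁ (proj₂ (split p route))) end≡n) (<⇒≢ (source<n e))

  -- The second index is what remains of the path after the forced edge.
  data Turn (e : Edge n) : Path n → Path n → Set where
    stop : target e ≡ n → Turn e [] []
    turn : ∀ {f B} → target e < n → source f ≡ target e → slack f ≡ not (slack e) → Turn e (f ∷ B) B

  -- At target e the new prefix is extremal but not the cut, which forces the
  -- next edge.
  New-turn : ∀ {j c e Q} → 2 ≤ j → IsCut C j c → source e ≡ j → New (e ∷ c) → R ≡ (e ∷ c) ʳ++ Q →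
    R ∈ C → ∃[ B ] Turn e Q B
  New-turn {c = c} {e} {Q} 2≤j isCut e₁ new eq R∈C with m≤n⇒m<n∨m≡n (target≤n e)
  ... | inj₂ ≡n with refl ← New-at-end (e ∷ c) {Q} eq ≡n = [] , stop ≡n
  New-turn {c = c} {e} {[]} 2≤j isCut e₁ new refl R∈C | inj₁ <n =
    contradiction (proj₂ (split (e ∷ c) route)) (<⇒≢ <n)
  New-turn {c = c} {e} {f ∷ B} 2≤j isCut e₁ new refl R∈C | inj₁ <n =
    B , turn <n (proj₁ (proj₂ (split (e ∷ c) route))) (¬-not same)
    where
    d-cut = cut isMax (2≤target e) <n
    same : slack f ≢ slack e
    same s = New≢cut (≤-trans (n≤1+n 1) (2≤target e)) <n new (proj₂ d-cut)
      -- A next edge of the slackness of `e` would put `e ∷ c` on that side of the cut at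
      -- `target e`; being extreme on the opposite end of that side's order, it would equal the cut.
      (Side-antisym (slack e)
        (cut-extremal isMax isCut 2≤j e₁ <n
          (IsCut⇒Pre (proj₂ d-cut) (≤-trans (n≤1+n 1) (2≤target e)) <n) (IsCut.end≡ (proj₂ d-cut)))
        (subst (λ s → Side s (proj₁ d-cut) (e ∷ c)) s (Pre⇒Side isMax (proj₂ d-cut) <n (B , R∈C) refl)))

  module _ {c T} (eq : R ≡ c ʳ++ T) (old : Pre C′ c) where

    -- A new prefix is a prefix of `R`, and those contained in `c` occur in `C′` because `c` does.
    New⇒∈ : ∀ {g p} → New (g ∷ p) → g ∈ T
    New⇒∈ {g} {p} new with New⇒prefix new
    ... | B , eq′ with ʳ++-comparable c (g ∷ p) (trans (sym eq) eq′)
    ...   | inj₁ (M , refl)    = contradiction (Pre-drop M old) (proj₂ new)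
    ...   | inj₂ ([] , refl)   = contradiction old (proj₂ new)
    ...   | inj₂ (_ ∷ M , refl) = subst (g ∈_) (sym T≡) (∈-ʳ++ M)
      where
      T≡ : T ≡ M ʳ++ (g ∷ B)
      T≡ = ʳ++-cancelˡ c (trans (sym eq) (trans eq′ (++-ʳ++ M)))
      ∈-ʳ++ : ∀ M {B} → g ∈ M ʳ++ (g ∷ B)
      ∈-ʳ++ M {B} = subst (g ∈_) (sym (ʳ++-defn M)) (∈-++⁺ʳ (reverse M) (here refl))

  ∈⇒New : ∀ {e} p {Q} → R ∈ C → New (e ∷ p) → R ≡ p ʳ++ (e ∷ Q) → ∀ {g} → g ∈ e ∷ Q → ∃[ q ] New (g ∷ q)
  ∈⇒New _ R∈C new eq (here refl) = _ , new
  ∈⇒New {e} p {f ∷ Q} R∈C new eq (there g∈) =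
    ∈⇒New (e ∷ p) R∈C (New-∷ new (Q , subst (_∈ C) eq R∈C)) eq g∈

  -- Two new prefixes followed by `g` are prefixes of `R` ending at `source g`, hence equal. So
  -- membership of `g` in the tail `T` decides between none and exactly one.
  newBefore : ∀ {c T g} → R ≡ c ʳ++ T → Pre C′ c → (∀ {g} → g ∈ T → ∃[ q ] New (g ∷ q)) →
    (d : Dec (g ∈ T)) → ∃[ l ] Unique l × length l ≡ # d × (∀ {P} → P ∈ l ⇔ New (g ∷ reverse P))
  newBefore eq old _ (no g∉) = [] , [] , refl , mk⇔ (λ ()) (λ new → contradiction (New⇒∈ eq old new) g∉)
  newBefore {g = g} eq old new∈ (yes g∈) with new∈ g∈
  ... | q , new = [ reverse q ] , [] ∷ [] , refl , mk⇔ to from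
    where
    to : ∀ {P} → P ∈ [ reverse q ] → New (g ∷ reverse P)
    to (here refl) = subst (λ q → New (g ∷ q)) (sym (reverse-involutive q)) new
    from : ∀ {P} → New (g ∷ reverse P) → P ∈ [ reverse q ]
    from {P} new′ with New⇒prefix new | New⇒prefix new′
    ... | _ , eq₁ | _ , eq₂ = here (trans (sym (reverse-involutive P)) (cong reverse
          (New-end-injective (reverse P) q eq₂ eq₁
            (trans (sym (source-Pre isClique (proj₁ new′))) (source-Pre isClique (proj₁ new))))))

-- Two cliques differing by one route.

module Flips {n : ℕ} (3≤n : 3 ≤ n) {C C′ : List (Path n)}
  (isMax : IsMaximalClique C) (isMax′ : IsMaximalClique C′) {R R′ : Path n}
  (R∈C : R ∈ C) (R∉C′ : R ∉ C′) (R′∈C′ : R′ ∈ C′)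
  (only : ∀ {T} → T ∈ C → T ∉ C′ → T ≡ R) (only′ : ∀ {T} → T ∈ C′ → T ∉ C → T ≡ R′) where

  open Zigzag 3≤n
  open IsMaximalClique isMax using (isClique)
  open IsMaximalClique isMax′ using () renaming (isClique to isClique′)

  route : IsRoute R
  route = IsClique.routes isClique R∈C

  route′ : IsRoute R′
  route′ = IsClique.routes isClique′ R′∈C′

  module F = Flip 3≤n {C} {C′} isMax route only
  module F′ = Flip 3≤n {C′} {C} isMax′ route′ only′

  -- The comparison is with prefixes common to both cliques, since the cuts that steer `R` and `R′`
  -- in `follow` are such prefixes.
  SamePosition : Path n → Path n → Set
  SamePosition r r′ = end r < n → ∀ {q} → Pre C q → Pre C′ q → end q ≡ end r →
    (q ⊏ r × q ⊏ r′) ⊎ (r ⊏ q × r′ ⊏ q)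

  -- A cut of C at end r is not new, so it is also a cut of C′, and it lies on
  -- the same side of r and of r′.
  follow : ∀ {r r′} B B′ → F.New r → F′.New r′ → end r ≡ end r′ → 2 ≤ end r → SamePosition r r′ →
    R ≡ r ʳ++ B → R′ ≡ r′ ʳ++ B′ → B ≡ B′
  follow {r} {r′} [] B′ _ _ ends _ _ refl eq′ =
    sym (F′.New-at-end r′ eq′ (trans (sym ends) (proj₂ (split r route))))
  follow {r} {r′} (e ∷ B) [] _ _ ends _ _ eq refl =
    F.New-at-end r eq (trans ends (proj₂ (split r′ route′)))
  follow {r} {r′} (e ∷ B) (e′ ∷ B′) new new′ ends 2≤ same refl refl =
    step e≡e′
    where
    e₁ : source e ≡ end r
    e₁ = proj₁ (proj₂ (split r route))
    e′₁ : source e′ ≡ end r′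
    e′₁ = proj₁ (proj₂ (split r′ route′))
    j<n : end r < n
    j<n = subst (_< n) e₁ (source<n e)
    1≤j = 1≤end r

    d = proj₁ (cut isMax 2≤ j<n)
    d-cut : IsCut C (end r) d
    d-cut = proj₂ (cut isMax 2≤ j<n)
    open IsCut d-cut

    followed′ : ∀ {g} → source g ≡ end r → Pre C′ (g ∷ d)
    followed′ {g} g₁ with Pre? C′ (g ∷ d)
    ... | yes h = h
    -- Otherwise `R` would pass through `d`, so `d` would be `r`, which is new and hence not a cut.
    ... | no ¬h with F.New⇒prefix (followed g₁ , ¬h)
    ...   | _ , eq = contradiction (F.New-end-injective r d refl eq (sym end≡)) (F.New≢cut 1≤j j<n new d-cut)

    d-cut′ : IsCut C′ (end r) d
    d-cut′ = record { end≡ = end≡ ; followed = followed′ }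

    slack-below : ∀ {e r} → d ⊏ r → Side (slack e) d r → slack e ≡ false
    slack-below {edge (x _) _} d⊏r r≼d = contradiction d⊏r (≼⇒⊐̸ r≼d)
    slack-below {edge (y _) _} _ _ = refl

    slack-above : ∀ {e r} → r ⊏ d → Side (slack e) d r → slack e ≡ true
    slack-above {edge (x _) _} _ _ = refl
    slack-above {edge (y _) _} r⊏d d≼r = contradiction r⊏d (≼⇒⊐̸ d≼r)

    side : Side (slack e) d r
    side = Pre⇒Side isMax d-cut j<n (B , R∈C) refl
    side′ : Side (slack e′) d r′
    side′ = Pre⇒Side isMax′ d-cut′ j<n (B′ , R′∈C′) (sym ends)

    slacks : slack e ≡ slack e′
    slacks with same j<n (IsCut⇒Pre d-cut 1≤j j<n) (IsCut⇒Pre d-cut′ 1≤j j<n) end≡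
    ... | inj₁ (d⊏r , d⊏r′) = trans (slack-below {e} d⊏r side) (sym (slack-below {e′} d⊏r′ side′))
    ... | inj₂ (r⊏d , r′⊏d) = trans (slack-above {e} r⊏d side) (sym (slack-above {e′} r′⊏d side′))

    e≡e′ : e ≡ e′
    e≡e′ = source-slack-injective (subst (2 ≤_) (sym e₁) 2≤) (trans e₁ (trans ends (sym e′₁))) slacks

    -- A common prefix arriving along `e` compares as before it; one arriving along the other edge
    -- is compared by the last edge alone, with the same result for both.
    same∷ : SamePosition (e ∷ r) (e ∷ r′)
    same∷ lt {[]} _ _ eq = contradiction (subst (2 ≤_) (sym eq) (2≤target e)) λ { (s≤s ()) }
    same∷ lt {g ∷ q} h h′ eq = cases (slack g ≟ᵇ slack e)
      where
      cases : Dec (slack g ≡ slack e) → (g ∷ q ⊏ e ∷ r × g ∷ q ⊏ e ∷ r′) ⊎ (e ∷ r ⊏ g ∷ q × e ∷ r′ ⊏ g ∷ q)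
      cases (yes s) with refl ← target-slack-injective {e = e} {g} lt (sym eq) (sym s)
        with same j<n (Pre-tail h) (Pre-tail h′) (trans (sym (source-Pre isClique h)) e₁)
      ... | inj₁ (q⊏r , q⊏r′) = inj₁ (there q⊏r , there q⊏r′)
      ... | inj₂ (r⊏q , r′⊏q) = inj₂ (there r⊏q , there r′⊏q)
      cases (no ≢) = opposite (slack e) refl (¬-not ≢)
        where
        opposite : ∀ s → slack e ≡ s → slack g ≡ not s →
          (g ∷ q ⊏ e ∷ r × g ∷ q ⊏ e ∷ r′) ⊎ (e ∷ r ⊏ g ∷ q × e ∷ r′ ⊏ g ∷ q)
        opposite true  a b = inj₁ (here b a , here b a)
        opposite false a b = inj₂ (here a b , here a b)

    step : e ≡ e′ → e ∷ B ≡ e′ ∷ B′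
    step refl = cong (e ∷_) (follow B B′ (F.New-∷ new (B , R∈C)) (F′.New-∷ new′ (B′ , R′∈C′))
      refl (2≤target e) same∷ refl refl)

  -- `old` and `old′` record what the agreement of the cliques before `b` yields: both cuts occur in
  -- both cliques, so new prefixes arise only beyond them. The record is symmetric, so the cliques
  -- can be exchanged.
  record Divergence (b : ℕ) (c c′ : Path n) : Set where
    field
      2≤b   : 2 ≤ b
      b<n   : b < n
      isCut  : IsCut C b c
      isCut′ : IsCut C′ b c′
      old   : Pre C′ c
      old′  : Pre C c′

  Agree : ℕ → Set
  Agree j = ∀ e p → source e < j → Pre C (e ∷ p) ⇔ Pre C′ (e ∷ p)

  Agree-here : ∀ {j p} → Agree j → 2 ≤ j → end p ≡ j → Pre C p ⇔ Pre C′ p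
  Agree-here {p = []}    _     2≤j refl = contradiction 2≤j λ { (s≤s ()) }
  Agree-here {p = e ∷ p} agree _   refl = agree e p (source<target e)

  -- Induction along the vertices: given the same prefixes at a vertex and the same cut, `Pre⇒Side`
  -- and `Side⇒Pre` determine the continuations, so agreement passes to the next vertex.
  findDivergence : ∀ i → 2 + i ≤ n → Agree (2 + i) ⊎
    (∃[ b ] ∃[ c ] ∃[ c′ ] Divergence b c c′ × (c ⊏ c′ ⊎ c′ ⊏ c))
  findDivergence zero _ = inj₁ agree
    where
    end≡1⇒[] : ∀ p → end {n} p ≡ 1 → p ≡ []
    end≡1⇒[] []      _  = refl
    end≡1⇒[] (e ∷ _) eq = contradiction (subst (2 ≤_) eq (2≤target e)) λ { (s≤s ()) }

    source≡1 : ∀ {e : Edge n} → source e < 2 → source e ≡ 1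
    source≡1 {e} lt = ≤-antisym (≤-pred lt) (1≤source e)

    transport : ∀ {D D′ e p} → IsMaximalClique D → IsMaximalClique D′ → source e < 2 →
      Pre D (e ∷ p) → Pre D′ (e ∷ p)
    transport {e = e} {p} m m′ lt h
      with refl ← end≡1⇒[] p (trans (sym (source-Pre (IsMaximalClique.isClique m) h)) (source≡1 {e} lt)) =
      initial m′ (source≡1 {e} lt)

    agree : Agree 2
    agree _ _ lt = mk⇔ (transport isMax isMax′ lt) (transport isMax′ isMax lt)
  findDivergence (suc i) j<n with findDivergence i (<⇒≤ j<n)
  ... | inj₂ found = inj₂ found
  ... | inj₁ agree = compare
    where
    j = 2 + i
    2≤j : 2 ≤ j
    2≤j = s≤s (s≤s z≤n)
    1≤j : 1 ≤ j
    1≤j = s≤s z≤n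
    c = proj₁ (cut isMax 2≤j j<n)
    c-cut = proj₂ (cut isMax 2≤j j<n)
    c′ = proj₁ (cut isMax′ 2≤j j<n)
    c′-cut = proj₂ (cut isMax′ 2≤j j<n)
    hc = IsCut⇒Pre c-cut 1≤j j<n
    hc′ = IsCut⇒Pre c′-cut 1≤j j<n

    divergence : Divergence j c c′
    divergence = record
      { 2≤b = 2≤j ; b<n = j<n ; isCut = c-cut ; isCut′ = c′-cut
      ; old  = Equivalence.to (Agree-here agree 2≤j (IsCut.end≡ c-cut)) hc
      ; old′ = Equivalence.from (Agree-here agree 2≤j (IsCut.end≡ c′-cut)) hc′ }

    transport : ∀ {D D′} → (m : IsMaximalClique D) (m′ : IsMaximalClique D′) →
      (∀ {p} → end p ≡ j → Pre D p → Pre D′ p) → ∀ {d} → IsCut D j d → IsCut D′ j d →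
      ∀ {e p} → source e ≡ j → Pre D (e ∷ p) → Pre D′ (e ∷ p)
    transport m m′ to d-cut d-cut′ {e} {p} e₁ h =
      Side⇒Pre m′ d-cut′ 2≤j j<n (end-p , to end-p (Pre-tail h)) e₁ (Pre⇒Side m d-cut j<n h end-p)
      where
      end-p = trans (sym (source-Pre (IsMaximalClique.isClique m) h)) e₁

    agree-suc : c ≡ c′ → Agree (suc j)
    agree-suc c≡c′ e p lt with m≤n⇒m<n∨m≡n (≤-pred lt)
    ... | inj₁ lt′ = agree e p lt′
    ... | inj₂ e₁ = mk⇔
      (transport isMax isMax′ (λ eq → Equivalence.to (Agree-here agree 2≤j eq))
        c-cut (subst (IsCut C′ j) (sym c≡c′) c′-cut) e₁)
      (transport isMax′ isMax (λ eq → Equivalence.from (Agree-here agree 2≤j eq))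
        c′-cut (subst (IsCut C j) c≡c′ c-cut) e₁)

    compare : Agree (suc j) ⊎ (∃[ b ] ∃[ c ] ∃[ c′ ] Divergence b c c′ × (c ⊏ c′ ⊎ c′ ⊏ c))
    compare with ⊏-total c c′ (Pre⇒Chain isClique hc) (Pre⇒Chain isClique′ hc′)
                   (trans (IsCut.end≡ c-cut) (sym (IsCut.end≡ c′-cut)))
                   (subst (_< n) (sym (IsCut.end≡ c-cut)) j<n)
    ... | inj₁ (inj₁ c≡c′) = inj₁ (agree-suc c≡c′)
    ... | inj₁ (inj₂ c⊏c′) = inj₂ (j , c , c′ , divergence , inj₁ c⊏c′)
    ... | inj₂ c′⊏c        = inj₂ (j , c , c′ , divergence , inj₂ c′⊏c)

  -- Agreement at the last edge of `R` would make `R` a prefix of a route of `C′`; no edge leaves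
  -- `n`, so that route would be `R` itself.
  ¬Agree : ¬ Agree n
  ¬Agree agree = go (reverse R) (trans (reverse-ʳ++ R) (++-identityʳ R))
    where
    go : ∀ r → r ʳ++ [] ≡ R → ⊥
    go []      refl = contradiction route (<⇒≢ (≤-trans (n≤1+n 2) 3≤n))
    go (e ∷ r) refl with Equivalence.to (agree e r (source<n e)) ([] , R∈C)
    ... | []    , h = R∉C′ h
    ... | g ∷ B , h =
      contradiction
        (trans (proj₁ (proj₂ (split (e ∷ r) (IsClique.routes isClique′ h)))) (proj₂ (split (e ∷ r) route)))
        (<⇒≢ (source<n g))

  divergence : ∃[ b ] ∃[ c ] ∃[ c′ ] Divergence b c c′ × (c ⊏ c′ ⊎ c′ ⊏ c)
  divergence with m≤n⇒∃[o]m+o≡n (≤-trans (n≤1+n 2) 3≤n)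
  ... | i , eq with findDivergence i (≤-reflexive eq)
  ...   | inj₁ agree = contradiction (subst Agree eq agree) ¬Agree
  ...   | inj₂ found = found

  -- The exchange of prefixes at a divergence.

  module AtDivergence {b c c′} (div : Divergence b c c′) (c⊏c′ : c ⊏ c′) where
    open Divergence div

    1≤b : 1 ≤ b
    1≤b = ≤-trans (n≤1+n 1) 2≤b

    yᵇ xᵇ : Edge n
    yᵇ = out false 1≤b b<n
    xᵇ = out true 1≤b b<n

    yᵇ-source : source yᵇ ≡ b
    yᵇ-source = source-out false 1≤b b<n

    -- Strictly below its cut `c′`, the clique `C′` follows `c` by the slack edge only; `new′` is
    -- the mirror image.
    new : F.New (yᵇ ∷ c)
    new = IsCut.followed isCut {e = yᵇ} yᵇ-source ,
      λ h → ≼⇒⊐̸ (Pre⇒Side isMax′ isCut′ b<n h (IsCut.end≡ isCut)) c⊏c′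

    new′ : F′.New (xᵇ ∷ c′)
    new′ = IsCut.followed isCut′ {e = xᵇ} refl ,
      λ h → ≼⇒⊐̸ (Pre⇒Side isMax isCut b<n h (IsCut.end≡ isCut′)) c⊏c′

    Q Q′ : Path n
    Q  = proj₁ (F.New⇒prefix new)
    Q′ = proj₁ (F′.New⇒prefix new′)

    R≡ : R ≡ (yᵇ ∷ c) ʳ++ Q
    R≡ = proj₂ (F.New⇒prefix new)

    R′≡ : R′ ≡ (xᵇ ∷ c′) ʳ++ Q′
    R′≡ = proj₂ (F′.New⇒prefix new′)

    y-extremal : ∀ {q} → target yᵇ < n → Pre C q → end q ≡ target yᵇ → yᵇ ∷ c ≼ q
    y-extremal lt h eq = cut-extremal isMax isCut 2≤b yᵇ-source lt h eq

    x-extremal : ∀ {q} → target xᵇ < n → Pre C′ q → end q ≡ target xᵇ → q ≼ xᵇ ∷ c′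
    x-extremal lt h eq = cut-extremal isMax′ {e = xᵇ} isCut′ 2≤b refl lt h eq

    -- A common prefix arriving along the slack edge `f` lies above both: above the first because
    -- `yᵇ ∷ c` is lowest and not common, above the second by the last edge. Arriving along `f′` it
    -- lies below both, symmetrically.
    samePosition : ∀ {f f′} → target yᵇ < n → target xᵇ < n → source f ≡ target yᵇ → source f′ ≡ target xᵇ →
      slack f ≡ true → slack f′ ≡ false → target f ≡ target f′ →
      SamePosition (f ∷ yᵇ ∷ c) (f′ ∷ xᵇ ∷ c′)
    samePosition {f} _ _ _ _ _ _ _ _ {[]} _ _ eq = contradiction (subst (2 ≤_) (sym eq) (2≤target f)) λ { (s≤s ()) }
    samePosition {f} {f′} y<n x<n f₁ f′₁ sf sf′ ends lt {g ∷ q} h h′ eq = cases (slack g) refl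
      where
      end-q : source g ≡ end q
      end-q = source-Pre isClique h

      above : yᵇ ∷ c ≼ q → yᵇ ∷ c ⊏ q
      above (inj₁ refl) = contradiction (Pre-tail h′) (proj₂ new)
      above (inj₂ y⊏q)  = y⊏q

      below : q ≼ xᵇ ∷ c′ → q ⊏ xᵇ ∷ c′
      below (inj₁ refl) = contradiction (Pre-tail h) (proj₂ new′)
      below (inj₂ q⊏x)  = q⊏x

      cases : ∀ s → slack g ≡ s →
        (g ∷ q ⊏ f ∷ yᵇ ∷ c × g ∷ q ⊏ f′ ∷ xᵇ ∷ c′) ⊎ (f ∷ yᵇ ∷ c ⊏ g ∷ q × f′ ∷ xᵇ ∷ c′ ⊏ g ∷ q)
      cases true sg with refl ← target-slack-injective {e = f} {g} lt (sym eq) (trans sf (sym sg)) =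
        inj₂ (there (above (y-extremal y<n (Pre-tail h) (trans (sym end-q) f₁))) , here sf′ sg)
      cases false sg with refl ← target-slack-injective {e = f′} {g} (subst (_< n) ends lt)
                             (trans (sym ends) (sym eq)) (trans sf′ (sym sg)) =
        inj₁ (here sg sf , there (below (x-extremal x<n (Pre-tail h′) (trans (sym end-q) f′₁))))

    -- The moved edges are given by labels so that one description also covers `b` near `n`, where
    -- some labels belong to no edge. The field `far` keeps the common edges apart from the moved
    -- ones.
    record Tails (Q Q′ : Path n) : Set where
      field
        common : Path n
        upper⁻ : ∀ {g} → g ∈ yᵇ ∷ Q → label g ∈ upper b ⊎ g ∈ common
        upper⁺ : ∀ {g} → label g ∈ upper b ⊎ g ∈ common → g ∈ yᵇ ∷ Q
        lower⁻ : ∀ {g} → g ∈ xᵇ ∷ Q′ → label g ∈ lower b ⊎ g ∈ common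
        lower⁺ : ∀ {g} → label g ∈ lower b ⊎ g ∈ common → g ∈ xᵇ ∷ Q′
        far    : ∀ {g} → g ∈ common → 3 + b ≤ source g

    y-stop : target yᵇ ≡ n → n ≤ 2 + b
    y-stop eq = subst (_≤ 2 + b) eq (m⊓n≤n n (2 + b))

    lower-step : ∀ {f : Edge n} → source f ≡ target xᵇ → slack f ≡ false → label f ≡ y (1 + b)
    lower-step f₁ sf = nonslack-label (≤-trans 2≤b (n≤1+n b)) sf f₁

    -- If both routes stop, `b` is the last inner vertex; if only `R` stops, `b` is the one before
    -- it, and `R′` ends with `y (1 + b)`. That only `R′` stops is impossible, as `y b` reaches at
    -- least as far as `x b`. Otherwise the routes meet again at `3 + b`, and `follow` identifies
    -- the rest.
    tails : ∀ {Q Q′ B B′} → R ≡ (yᵇ ∷ c) ʳ++ Q → R′ ≡ (xᵇ ∷ c′) ʳ++ Q′ →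
      F.Turn yᵇ Q B → F′.Turn xᵇ Q′ B′ → Tails Q Q′
    tails _ _ (F.stop y≡n) (F′.stop x≡n) = record
      { common = []
      ; upper⁻ = λ { (here refl) → inj₁ (there (here refl)) }
      ; upper⁺ = λ { {g} (inj₁ (here eq)) → contradiction (label-x⇒<n {f = g} eq) (≤⇒≯ (y-stop y≡n))
                   ; (inj₁ (there (here eq))) → here (label-injective eq) }
      ; lower⁻ = λ { (here refl) → inj₁ (here refl) }
      ; lower⁺ = λ { (inj₁ (here eq)) → here (label-injective eq)
                   ; {g} (inj₁ (there (here eq))) → contradiction (label-y⇒<n {f = g} eq) (<-irrefl x≡n) }
      ; far    = λ ()
      }
    tails R≡ R′≡ (F.stop y≡n) (F′.turn {f′} x<n f′₁ sf′)
      with refl ← F′.New-at-end (f′ ∷ xᵇ ∷ c′) R′≡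
                    (trans (target-y {f = f′} (lower-step {f′} f′₁ sf′))
                      (m≤n⇒m⊓n≡m (≤-trans (y-stop y≡n) (n≤1+n _)))) = record
      { common = []
      ; upper⁻ = λ { (here refl) → inj₁ (there (here refl)) }
      ; upper⁺ = λ { {g} (inj₁ (here eq)) → contradiction (label-x⇒<n {f = g} eq) (≤⇒≯ (y-stop y≡n))
                   ; (inj₁ (there (here eq))) → here (label-injective eq) }
      ; lower⁻ = λ { (here refl) → inj₁ (here refl)
                   ; (there (here refl)) → inj₁ (there (here (lower-step {f′} f′₁ sf′))) }
      ; lower⁺ = λ { (inj₁ (here eq)) → here (label-injective eq)
                   ; (inj₁ (there (here eq))) →
                       there (here (label-injective (trans eq (sym (lower-step {f′} f′₁ sf′))))) }
      ; far    = λ ()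
      }
    tails _ _ (F.turn y<n _ _) (F′.stop x≡n) =
      contradiction (subst (2 + b ≤_) (sym x≡n) (<⇒≤ (subst (_< n) (⊓<⇒≡ y<n) y<n))) 1+n≰n
    tails {B = B} {B′} R≡ R′≡ (F.turn {f} y<n f₁ sf) (F′.turn {f′} x<n f′₁ sf′) =
      rejoined (follow B B′
        (F.New-∷ new (B , subst (_∈ C) R≡ R∈C)) (F′.New-∷ new′ (B′ , subst (_∈ C′) R′≡ R′∈C′))
        ends (2≤target f) (samePosition y<n x<n f₁ f′₁ sf sf′ ends) R≡ R′≡)
      where
      f-label : label f ≡ x (2 + b)
      f-label = slack-label {f = f} sf (trans f₁ (⊓<⇒≡ y<n))

      f′-label : label f′ ≡ y (1 + b)
      f′-label = lower-step {f′} f′₁ sf′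

      -- Since `x (2 + b)` is an edge, `3 + b` is at most `n`, so the target of `y (1 + b)` is not
      -- truncated.
      ends : target f ≡ target f′
      ends = trans (target-x {f = f} f-label)
               (sym (trans (target-y {f = f′} f′-label)
                 (m≥n⇒m⊓n≡n (subst (_≤ n) (target-x {f = f} f-label) (target≤n f)))))

      rejoined : B ≡ B′ → Tails (f ∷ B) (f′ ∷ B′)
      rejoined refl = record
        { common = B
        ; upper⁻ = λ { (here refl) → inj₁ (there (here refl))
                     ; (there (here refl)) → inj₁ (here f-label)
                     ; (there (there g∈)) → inj₂ g∈ }
        ; upper⁺ = λ { (inj₁ (here eq)) → there (here (label-injective (trans eq (sym f-label))))
                     ; (inj₁ (there (here eq))) → here (label-injective eq)
                     ; (inj₂ g∈) → there (there g∈) }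
        ; lower⁻ = λ { (here refl) → inj₁ (here refl)
                     ; (there (here refl)) → inj₁ (there (here f′-label))
                     ; (there (there g∈)) → inj₂ g∈ }
        ; lower⁺ = λ { (inj₁ (here eq)) → here (label-injective eq)
                     ; (inj₁ (there (here eq))) → there (here (label-injective (trans eq (sym f′-label))))
                     ; (inj₂ g∈) → there (there g∈) }
        ; far    = λ {g} g∈ → subst (_≤ source g) (target-x {f = f} f-label)
                     (IsPath-source≥ B (proj₂ (split (f ∷ yᵇ ∷ c) (subst IsRoute R≡ route))) g∈)
        }

    allTails : Tails Q Q′
    allTails = tails R≡ R′≡ (proj₂ (F.New-turn 2≤b isCut yᵇ-source new R≡ R∈C))
                            (proj₂ (F′.New-turn {e = xᵇ} 2≤b isCut′ refl new′ R′≡ R′∈C′))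

    -- Both sides count the prefixes followed by `g` in at least one of the two cliques: all those
    -- of one clique, together with those new in the other.
    exchange : ∀ {g} (d : Dec (g ∈ yᵇ ∷ Q)) (d′ : Dec (g ∈ xᵇ ∷ Q′)) →
      # d′ + length (prefixesBefore C g) ≡ # d + length (prefixesBefore C′ g)
    exchange {g} d d′
      with F.newBefore R≡ old (F.∈⇒New c R∈C new R≡) d
         | F′.newBefore R′≡ old′ (F′.∈⇒New c′ R′∈C′ new′ R′≡) d′
    ... | l , ul , len , l⇔ | l′ , ul′ , len′ , l′⇔ = begin
      # d′ + length A        ≡⟨ cong (_+ length A) len′ ⟨
      length l′ + length A   ≡⟨ length-++ l′ ⟨
      length (l′ ++ A)       ≡⟨ ↭-length (∼bag⇒↭ (unique∧set⇒bag unique unique′ (mk⇔ to from))) ⟩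
      length (l ++ A′)       ≡⟨ length-++ l ⟩
      length l + length A′   ≡⟨ cong (_+ length A′) len ⟩
      # d + length A′        ∎
      where
      open ≡-Reasoning
      A  = prefixesBefore C g
      A′ = prefixesBefore C′ g
      module L {P} = Equivalence (l⇔ {P})
      module L′ {P} = Equivalence (l′⇔ {P})
      unique : Unique (l′ ++ A)
      unique = Unique-++⁺ ul′ (prefixesBefore-unique C g)
        (λ (∈l′ , ∈A) → proj₂ (L′.to ∈l′) (∈-prefixesBefore⁻ ∈A))
      unique′ : Unique (l ++ A′)
      unique′ = Unique-++⁺ ul (prefixesBefore-unique C′ g)
        (λ (∈l , ∈A′) → proj₂ (L.to ∈l) (∈-prefixesBefore⁻ ∈A′))
      to : ∀ {P} → P ∈ l′ ++ A → P ∈ l ++ A′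
      to {P} P∈ with ∈-++⁻ l′ P∈
      ... | inj₁ ∈l′ = ∈-++⁺ʳ l (∈-prefixesBefore⁺ (proj₁ (L′.to ∈l′)))
      ... | inj₂ ∈A with Pre? C′ (g ∷ reverse P)
      ...   | yes h = ∈-++⁺ʳ l (∈-prefixesBefore⁺ h)
      ...   | no ¬h = ∈-++⁺ˡ (L.from (∈-prefixesBefore⁻ ∈A , ¬h))
      from : ∀ {P} → P ∈ l ++ A′ → P ∈ l′ ++ A
      from {P} P∈ with ∈-++⁻ l P∈
      ... | inj₁ ∈l = ∈-++⁺ʳ l′ (∈-prefixesBefore⁺ (proj₁ (L.to ∈l)))
      ... | inj₂ ∈A′ with Pre? C (g ∷ reverse P)
      ...   | yes h = ∈-++⁺ʳ l′ (∈-prefixesBefore⁺ h)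
      ...   | no ¬h = ∈-++⁺ˡ (L′.from (∈-prefixesBefore⁻ ∈A′ , ¬h))

    -- An edge of the common tail adds one to each side and cancels. By `far` it carries no label of
    -- `lower b` or `upper b`, so the remaining terms are the two indicators.
    exchangeLabels : ∀ g →
      # (label g ∈ˡ? lower b) + length (prefixesBefore C g) ≡
      # (label g ∈ˡ? upper b) + length (prefixesBefore C′ g)
    exchangeLabels g = cancel (label g ∈ˡ? lower b) (label g ∈ˡ? upper b) (g ∈ᵉ? common)
      (exchange (map′ upper⁺ upper⁻ ((label g ∈ˡ? upper b) ⊎-dec (g ∈ᵉ? common)))
                (map′ lower⁺ lower⁻ ((label g ∈ˡ? lower b) ⊎-dec (g ∈ᵉ? common))))
      where
      open Tails allTails
      cancel : ∀ {k k′} (d : Dec (label g ∈ lower b)) (d′ : Dec (label g ∈ upper b)) (d″ : Dec (g ∈ common)) →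
        # (d ⊎-dec d″) + k ≡ # (d′ ⊎-dec d″) + k′ → # d + k ≡ # d′ + k′
      cancel (yes g∈) _        (yes g∈c) _  = contradiction (far g∈c) (<⇒≱ (proj₂ (source-lower 2≤b g g∈)))
      cancel (no _)   (yes g∈) (yes g∈c) _  = contradiction (far g∈c) (<⇒≱ (proj₂ (source-upper 2≤b g g∈)))
      cancel (no _)   (no _)   (yes _)   eq = suc-injective eq
      cancel (yes _)  (yes _)  (no _)    eq = eq
      cancel (yes _)  (no _)   (no _)    eq = eq
      cancel (no _)   (yes _)  (no _)    eq = eq
      cancel (no _)   (no _)   (no _)    eq = eq

-- From prefix counts to flow values.

module _ {n : ℕ} (3≤n : 3 ≤ n) where
  open Zigzag 3≤n

  φ-inner : ∀ (Δ : Simplex n) e → 2 ≤ source e → φ Δ e ≡ + length (prefixesBefore (clique Δ) e) ℤ.- 1ℤ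
  φ-inner Δ e 2≤ = cong (λ b → if b then 0ℤ else + length (prefixesBefore (clique Δ) e) ℤ.- 1ℤ)
    (dec-false (source e ≟ 1) (λ eq → <⇒≢ 2≤ (sym eq)))

  φ-initial : ∀ (Δ : Simplex n) e → source e ≡ 1 → φ Δ e ≡ 0ℤ
  φ-initial Δ e eq = cong (λ b → if b then 0ℤ else + length (prefixesBefore (clique Δ) e) ℤ.- 1ℤ)
    (dec-true (source e ≟ 1) eq)

  -- The cut at `source e` is always counted.
  prefixesBefore-nonempty : ∀ (Δ : Simplex n) {e} → 2 ≤ source e → 1 ≤ length (prefixesBefore (clique Δ) e)
  prefixesBefore-nonempty Δ {e} 2≤ =
    ∈⇒1≤ (∈-prefixesBefore⁺ {P = reverse c} (subst (λ c → Pre (clique Δ) (e ∷ c))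
    (sym (reverse-involutive c)) (IsCut.followed isCut {e = e} refl)))
    where
    c = proj₁ (cut (isMaximalClique Δ) 2≤ (source<n e))
    isCut = proj₂ (cut (isMaximalClique Δ) 2≤ (source<n e))
    ∈⇒1≤ : ∀ {P} {Ps : List (Path n)} → P ∈ Ps → 1 ≤ length Ps
    ∈⇒1≤ (here _)  = s≤s z≤n
    ∈⇒1≤ (there _) = s≤s z≤n

  indicator-# : ∀ ls (e : Edge n) → indicator ls e ≡ + # (label e ∈ˡ? ls)
  indicator-# ls e with does (label e ∈ˡ? ls)
  ... | true  = refl
  ... | false = refl

  -- Applicability of the move follows from the counts: on `from` the count for `Δ` is one more than
  -- that for `Δ′`, which is at least one, so the flow of `Δ` is positive there.
  φ-transfer : ∀ (Δ Δ′ : Simplex n) {from to} →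
    (∀ e → label e ∈ from → 2 ≤ source {n} e) → (∀ e → label e ∈ to → 2 ≤ source {n} e) →
    (∀ {l} → l ∈ from → l ∉ to) →
    (∀ e → # (label e ∈ˡ? to) + length (prefixesBefore (clique Δ) e) ≡
           # (label e ∈ˡ? from) + length (prefixesBefore (clique Δ′) e)) →
    PositiveOn from (φ Δ) × (∀ e → φ Δ′ e ≡ transfer from to (φ Δ) e)
  φ-transfer Δ Δ′ {from} {to} from≥2 to≥2 disjoint eq = positive , transferred
    where
    L L′ : Edge n → ℕ
    L  e = length (prefixesBefore (clique Δ) e)
    L′ e = length (prefixesBefore (clique Δ′) e)

    #-no : ∀ {ls} e → label e ∉ ls → # (label e ∈ˡ? ls) ≡ 0
    #-no e ∉ls = cong (λ b → if b then 1 else 0) (dec-false (label e ∈ˡ? _) ∉ls)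

    #-yes : ∀ {ls} e → label e ∈ ls → # (label e ∈ˡ? ls) ≡ 1
    #-yes e ∈ls = cong (λ b → if b then 1 else 0) (dec-true (label e ∈ˡ? _) ∈ls)

    positive : PositiveOn from (φ Δ)
    positive e e∈ = subst (0ℤ ℤ.<_) (sym (φ-inner Δ e (from≥2 e e∈))) (pos (L e) (begin
      2                            ≤⟨ s≤s (prefixesBefore-nonempty Δ′ (from≥2 e e∈)) ⟩
      1 + L′ e                     ≡⟨ cong (_+ L′ e) (#-yes e e∈) ⟨
      # (label e ∈ˡ? from) + L′ e  ≡⟨ eq e ⟨
      # (label e ∈ˡ? to) + L e     ≡⟨ cong (_+ L e) (#-no e (disjoint e∈)) ⟩
      L e                          ∎))
      where
      open ≤-Reasoning
      pos : ∀ k → 2 ≤ k → 0ℤ ℤ.< + k ℤ.- 1ℤ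
      pos (suc (suc k)) _ = ℤ.+<+ (s≤s z≤n)
      pos (suc zero) (s≤s ())

    rearrange : ∀ (k k′ i j : ℤ) → j ℤ.+ k ≡ i ℤ.+ k′ → k′ ℤ.- 1ℤ ≡ k ℤ.- 1ℤ ℤ.- i ℤ.+ j
    rearrange k k′ i j eq = begin
      k′ ℤ.- 1ℤ                    ≡⟨ left k′ i ⟩
      (i ℤ.+ k′) ℤ.- 1ℤ ℤ.- i      ≡⟨ cong (λ s → s ℤ.- 1ℤ ℤ.- i) eq ⟨
      (j ℤ.+ k) ℤ.- 1ℤ ℤ.- i       ≡⟨ right k i j ⟩
      k ℤ.- 1ℤ ℤ.- i ℤ.+ j         ∎
      where
      open ≡-Reasoning
      left : ∀ k′ i → k′ ℤ.- 1ℤ ≡ (i ℤ.+ k′) ℤ.- 1ℤ ℤ.- i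
      left = solve-∀
      right : ∀ k i j → (j ℤ.+ k) ℤ.- 1ℤ ℤ.- i ≡ k ℤ.- 1ℤ ℤ.- i ℤ.+ j
      right = solve-∀

    transferred : ∀ e → φ Δ′ e ≡ transfer from to (φ Δ) e
    transferred e with m≤n⇒m<n∨m≡n (1≤source e)
    -- At vertex 1 both flows are zero by definition, and the indicators vanish because all moved
    -- edges leave later vertices.
    ... | inj₂ 1≡ = begin
      φ Δ′ e                                                    ≡⟨ φ-initial Δ′ e (sym 1≡) ⟩
      0ℤ                                                        ≡⟨⟩
      0ℤ ℤ.- 0ℤ ℤ.+ 0ℤ                                          ≡⟨ cong₂ (λ i j → 0ℤ ℤ.- i ℤ.+ j) (none from≥2) (none to≥2) ⟨
      0ℤ ℤ.- indicator from e ℤ.+ indicator to e                ≡⟨ cong shift (φ-initial Δ e (sym 1≡)) ⟨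
      φ Δ e ℤ.- indicator from e ℤ.+ indicator to e             ∎
      where
      open ≡-Reasoning
      shift : ℤ → ℤ
      shift f = f ℤ.- indicator from e ℤ.+ indicator to e
      none : ∀ {ls} → (∀ e → label e ∈ ls → 2 ≤ source {n} e) → indicator ls e ≡ 0ℤ
      none {ls} ≥2 = trans (indicator-# ls e) (cong +_ (#-no e (λ e∈ → <⇒≢ (≥2 e e∈) 1≡)))
    ... | inj₁ 2≤ = begin
      φ Δ′ e                                                    ≡⟨ φ-inner Δ′ e 2≤ ⟩
      + L′ e ℤ.- 1ℤ                                             ≡⟨ rearrange (+ L e) (+ L′ e) _ _ integral ⟩
      + L e ℤ.- 1ℤ ℤ.- indicator from e ℤ.+ indicator to e      ≡⟨ cong shift (φ-inner Δ e 2≤) ⟨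
      φ Δ e ℤ.- indicator from e ℤ.+ indicator to e             ∎
      where
      open ≡-Reasoning
      shift : ℤ → ℤ
      shift f = f ℤ.- indicator from e ℤ.+ indicator to e
      integral : indicator to e ℤ.+ + L e ≡ indicator from e ℤ.+ + L′ e
      integral = trans (cong (ℤ._+ + L e) (indicator-# to e))
                   (trans (cong +_ (eq e)) (cong (ℤ._+ + L′ e) (sym (indicator-# from e))))

  lower-upper-disjoint : ∀ {b l} → l ∈ lower b → l ∉ upper b
  lower-upper-disjoint (here refl) (here ())
  lower-upper-disjoint (here refl) (there (here ()))
  lower-upper-disjoint (there (here refl)) (here ())
  lower-upper-disjoint (there (here refl)) (there (here ()))

theorem4 : (n : ℕ) → 3 ≤ n → (Δ Δ′ : Simplex n) → Adjacent Δ Δ′ → AdjacentFlows (φ Δ) (φ Δ′)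
theorem4 n 3≤n Δ Δ′ (R , R′ , R∈C , R∉C′ , R′∈C′ , R′∉C , same) = conclude Given.divergence
  where
  only : ∀ {T} → T ∈ clique Δ → T ∉ clique Δ′ → T ≡ R
  only {T} T∈C T∉C′ with ≡-dec _≟ᵉ_ T R | ≡-dec _≟ᵉ_ T R′
  ... | yes T≡R | _        = T≡R
  ... | no _    | yes refl = contradiction T∈C R′∉C
  ... | no T≢R  | no T≢R′  = contradiction (Equivalence.to (same T T≢R T≢R′) T∈C) T∉C′

  only′ : ∀ {T} → T ∈ clique Δ′ → T ∉ clique Δ → T ≡ R′
  only′ {T} T∈C′ T∉C with ≡-dec _≟ᵉ_ T R | ≡-dec _≟ᵉ_ T R′
  ... | _        | yes T≡R′ = T≡R′
  ... | yes refl | no _     = contradiction T∈C′ R∉C′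
  ... | no T≢R   | no T≢R′  = contradiction (Equivalence.from (same T T≢R T≢R′) T∈C′) T∉C

  module Given = Flips 3≤n (isMaximalClique Δ) (isMaximalClique Δ′) R∈C R∉C′ R′∈C′ only only′
  module Swapped = Flips 3≤n (isMaximalClique Δ′) (isMaximalClique Δ) R′∈C′ R′∉C R∈C only′ only

  conclude : ∃[ b ] ∃[ c ] ∃[ c′ ] Given.Divergence b c c′ × (c ⊏ c′ ⊎ c′ ⊏ c) → AdjacentFlows (φ Δ) (φ Δ′)
  -- The lower cut belongs to `Δ`, so `R` supplies the lost prefixes before `y b` and `x (2 + b)`:
  -- the move subtracts on `upper b`.
  conclude (b , c , c′ , div , inj₁ c⊏c′) =
    b , (2≤b , b<n) , inj₂ (φ-transfer 3≤n Δ Δ′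
      (λ e e∈ → proj₁ (source-upper 2≤b e e∈)) (λ e e∈ → proj₁ (source-lower 2≤b e e∈))
      (λ u l → lower-upper-disjoint 3≤n l u) (Given.AtDivergence.exchangeLabels div c⊏c′))
    where open Given.Divergence div
  -- The cliques exchange roles, and the resulting equation of counts is read backwards.
  conclude (b , c , c′ , div , inj₂ c′⊏c) =
    b , (2≤b , b<n) , inj₁ (φ-transfer 3≤n Δ Δ′
      (λ e e∈ → proj₁ (source-lower 2≤b e e∈)) (λ e e∈ → proj₁ (source-upper 2≤b e e∈))
      (lower-upper-disjoint 3≤n) (λ e → sym (Swapped.AtDivergence.exchangeLabels div′ c′⊏c e)))
    where
    open Given.Divergence div
    div′ : Swapped.Divergence b c′ c
    div′ = record { 2≤b = 2≤b ; b<n = b<n ; isCut = isCut′ ; isCut′ = isCut ; old = old′ ; old′ = old }
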